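{- Let $p\ge5$ be a prime, let $K\in\mathbb{F}_p$ with $K\neq\pm2$, and put $C=K^2+2K$, $D=-(2K^3+3K^2)$. The Vieta graph of the cubic $x^2+y^2+z^2=xyz-C(x+y+z)+D$ over $\mathbb{F}_p$ satisfies the following. (a) If $K=0$: there are $p^2+1+3\sigma(-1)p$ vertices in total, of which $3p-11-3\sigma(-1)$ are deficient; there are $3\big(p-4-\sigma(-1)\big)$ vertices of degree $2$, $0$ of degree $1$, and $1$ of degree $0$. (b) If $K=-1$: there are $p^2+1+2\sigma(-3)p$ vertices in total, of which $3p-11$ are deficient; there are $3(p-4)$ vertices of degree $2$, $0$ of degree $1$, and $1$ of degree $0$. (c) If $K\neq 0,-1,\pm2$: there are $p^2+1+3\sigma(K^2-4)p$ vertices in total, of which $3p-14-3\sigma(-K-1)$ are deficient; there are $3\big(p-6-\sigma(-K-1)\big)$ vertices of degree $2$, $3$ of degree $1$, and $1$ of degree $0$.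
   Context: $\sigma:\mathbb{F}_p\to\{ -1,0,1\}\subset\mathbb{Z}$ denotes the quadratic character: $\sigma(a)=1$ if $a$ is a nonzero square, $\sigma(a)=-1$ if $a$ is a non-square, $\sigma(0)=0$. The Vieta graph of the equation $x^2+y^2+z^2=xyz-C(x+y+z)+D$ over $\mathbb{F}_p$ is the finite simple graph whose vertices are the solutions $(x,y,z)\in\mathbb{F}_p^3$, where two distinct vertices are joined by an edge whenever one is a Vieta flip of the other. The Vieta flips of $(x,y,z)$ are $(yz-C-x,y,z)$, $(x,xz-C-y,z)$, $(x,y,xy-C-z)$. Every vertex has degree at most $3$; a vertex is deficient if its degree is less than $3$. -}

module Defs where

open import Data.Bool using (if_then_else_)
open import Data.Fin using (Fin; toℕ; fromℕ<)
open import Data.Fin.Properties using (any?) renaming (_≟_ to _≟ᶠ_)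
open import Data.Integer as ℤ using (ℤ; +_; 0ℤ; 1ℤ; -1ℤ)
open import Data.Integer.DivMod using (_%ℕ_; n%ℕd<d)
open import Data.List using (List; _∷_; []; length; filter; allFin; cartesianProduct)
open import Data.List.Membership.Propositional using (_∈_)
import Data.List.Membership.DecPropositional as DecMembership
open import Data.Nat using (ℕ; NonZero; _<_; _<?_; _≟_)
open import Data.Product using (_×_; _,_)
open import Data.Product.Properties using (≡-dec)
open import Data.Sum using (_⊎_)
open import Relation.Binary.Definitions using (Decidable; DecidableEquality)
open import Relation.Binary.PropositionalEquality using (_≡_; _≢_)
open import Relation.Nullary.Decidable using (does; ¬?; _×-dec_; _⊎-dec_)
import Relation.Unary as U

-- The ring of integers modulo p, represented by least non-negative residues;
-- this is the field 𝔽_p when p is prime.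
𝔽 : ℕ → Set
𝔽 p = Fin p

module _ {p : ℕ} .{{_ : NonZero p}} where

  infix  8 -ᶠ_
  infixl 7 _*ᶠ_
  infixl 6 _+ᶠ_ _-ᶠ_

  fromℤ : ℤ → 𝔽 p
  fromℤ i = fromℕ< (n%ℕd<d i p)

  toℤ : 𝔽 p → ℤ
  toℤ a = + toℕ a

  _+ᶠ_ _*ᶠ_ _-ᶠ_ : 𝔽 p → 𝔽 p → 𝔽 p
  a +ᶠ b = fromℤ (toℤ a ℤ.+ toℤ b)
  a *ᶠ b = fromℤ (toℤ a ℤ.* toℤ b)
  a -ᶠ b = fromℤ (toℤ a ℤ.- toℤ b)

  -ᶠ_ : 𝔽 p → 𝔽 p
  -ᶠ a = fromℤ (ℤ.- toℤ a)

  σ : 𝔽 p → ℤ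
  σ a = if does (a ≟ᶠ fromℤ 0ℤ) then 0ℤ
        else if does (any? λ b → b *ᶠ b ≟ᶠ a) then 1ℤ
        else -1ℤ

module VietaGraph {p : ℕ} .{{_ : NonZero p}} (C D : 𝔽 p) where

  Point : Set
  Point = 𝔽 p × 𝔽 p × 𝔽 p

  _≟ᴾ_ : DecidableEquality Point
  _≟ᴾ_ = ≡-dec _≟ᶠ_ (≡-dec _≟ᶠ_ _≟ᶠ_)

  open DecMembership _≟ᴾ_ using (_∈?_)

  IsSolution : Point → Set
  IsSolution (x , y , z) =
    x *ᶠ x +ᶠ y *ᶠ y +ᶠ z *ᶠ z ≡ x *ᶠ y *ᶠ z -ᶠ C *ᶠ (x +ᶠ y +ᶠ z) +ᶠ D

  isSolution? : U.Decidable IsSolution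
  isSolution? (x , y , z) = _ ≟ᶠ _

  -- Lists every solution exactly once.
  vertices : List Point
  vertices = filter isSolution?
    (cartesianProduct (allFin p) (cartesianProduct (allFin p) (allFin p)))

  flips : Point → List Point
  flips (x , y , z) = (y *ᶠ z -ᶠ C -ᶠ x , y , z)
                    ∷ (x , x *ᶠ z -ᶠ C -ᶠ y , z)
                    ∷ (x , y , x *ᶠ y -ᶠ C -ᶠ z)
                    ∷ []

  Adjacent : Point → Point → Set
  Adjacent v w = v ≢ w × (w ∈ flips v ⊎ v ∈ flips w)

  adjacent? : Decidable Adjacent
  adjacent? v w = ¬? (v ≟ᴾ w) ×-dec ((w ∈? flips v) ⊎-dec (v ∈? flips w))

  degree : Point → ℕ
  degree v = length (filter (adjacent? v) vertices)

  Deficient : Point → Set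
  Deficient v = degree v < 3

  deficient? : U.Decidable Deficient
  deficient? v = degree v <? 3

  #vertices : ℕ
  #vertices = length vertices

  #deficient : ℕ
  #deficient = length (filter deficient? vertices)

  #ofDegree : ℕ → ℕ
  #ofDegree k = length (filter (λ v → degree v ≟ k) vertices)

{-# OPTIONS --safe #-}
module Submission where

open import Algebra.Bundles using (CommutativeRing)
import Algebra.Solver.Ring as RingSolver
open import Algebra.Solver.Ring.AlmostCommutativeRing using (fromCommutativeRing; _-Raw-AlmostCommutative⟶_)
open import Algebra.Structures using (IsCommutativeRing)
open import Data.Bool using (true; false; if_then_else_)
open import Data.Empty using (⊥-elim)
open import Data.Fin using (Fin; zero; suc; toℕ)
open import Data.Fin.Permutation using (permutation)
open import Data.Fin.Properties using (any?; toℕ-injective; toℕ-fromℕ<; toℕ<n) renaming (_≟_ to _≟ᶠ_)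
open import Data.Integer using (ℤ; +_; -[1+_]; 0ℤ; 1ℤ; -1ℤ; _+_; _-_; _*_; -_; _≤_; +≤+; -≤+)
import Data.Integer as ℤ
open import Data.Integer.DivMod using (_%ℕ_; _/ℕ_; n%ℕd<d; a≡a%ℕn+[a/ℕn]*n)
import Data.Integer.Properties as ℤ
open import Data.Integer.Tactic.RingSolver using (solve-∀)
open import Data.List using (List; []; _∷_; _++_; map; length; filter; allFin; tabulate; cartesianProduct)
open import Data.List.Membership.Propositional using (_∈_)
open import Data.List.Membership.Propositional.Properties using (∈-filter⁺; ∈-filter⁻; ∈-cartesianProduct⁺; ∈-allFin)
open import Data.List.Membership.Propositional.Properties.WithK using (unique∧set⇒bag)
open import Data.List.Relation.Binary.BagAndSetEquality using (∼bag⇒↭)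
open import Data.List.Relation.Binary.Permutation.Propositional.Properties using (↭-length)
open import Data.List.Relation.Unary.All as All using ([]; _∷_)
open import Data.List.Relation.Unary.All.Properties using () renaming (filter⁺ to All-filter⁺)
open import Data.List.Relation.Unary.AllPairs using (AllPairs; []; _∷_)
open import Data.List.Relation.Unary.Any using (here; there)
open import Data.List.Relation.Unary.Unique.Propositional using (Unique)
open import Data.List.Relation.Unary.Unique.Propositional.Properties using (filter⁺; cartesianProduct⁺; allFin⁺)
open import Data.Maybe using (Maybe; just; nothing)
open import Data.Nat using (ℕ; zero; suc; NonZero; _≥_; _<_; z≤n; s≤s; _≟_; _<?_)
import Data.Nat as ℕ
open import Data.Nat.Coprimality using (prime⇒coprime; coprime-Bézout)
import Data.Nat.DivMod as ℕ
open import Data.Nat.GCD using (module Bézout)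
open import Data.Nat.Primality using (Prime)
import Data.Nat.Properties as ℕ
open import Data.Product using (_×_; _,_; ∃; proj₁; proj₂)
open import Data.Sum using (_⊎_; inj₁; inj₂)
open import Function using (_∘_; id; mk⇔)
open import Level using (0ℓ)
open import Relation.Binary.Definitions using (DecidableEquality)
open import Relation.Binary.PropositionalEquality
  using (_≡_; _≢_; refl; sym; trans; cong; cong₂; subst; isEquivalence; module ≡-Reasoning)
open import Relation.Nullary using (¬_; Dec; yes; no; does)
open import Relation.Nullary.Decidable using (_×-dec_; ¬?)
import Relation.Unary as U
open import Algebra.Properties.Semiring.Sum ℤ.+-*-semiring
  using (sum; sum-cong-≗; ∑-distrib-+; ∑-comm; ∑-permute; *-distribˡ-sum)

-- Translating by K moves the singular point (-K, -K, -K) to the origin and turns the equation into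
-- a² + b² + c² + K (ab + bc + ca) = abc, and the flip of a fixes a point iff 2a = bc - K (b + c).
-- For fixed b and c the equation is quadratic in a, so it has 1 + σ (disc b c) solutions, where
-- disc b c is quadratic in c and its own discriminant 16 b² (b - κ)(b + κ (K + 1)), κ = K - 2,
-- factors completely. Two applications of Σ σ (αx² + βx + γ) = σ(α) (p [Δ = 0] - 1) count the
-- vertices. The vertices fixed by one flip correspond to the zeros of disc, counted in the same
-- way; the only vertices fixed by two flips are the origin, which is fixed by all three, and, for
-- K ≠ 0, -1, one more for each pair of flips. Since the degree of a vertex is the number of flips
-- that move it, inclusion and exclusion gives the number of vertices of each degree.

-- The obstacle is degeneration: `disc b c` stops being quadratic in `c` at `b = κ` and at `b = ν`,
-- and whether it is then linear or constant depends on `K`. The sums over `c` are therefore stated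
-- as closed formulas in `b` whose `δ` terms make the degenerate rows obey them too; only then is
-- the sum over `b` taken. The case distinction of the theorem thereby reduces to evaluating four
-- quantities: the signs `s₊ = σ (K² - 4)` and `s₋ = σ (-K - 1)`, the number `n₀` of zeros of the
-- cubic `z`, and the number `n₁` of further points fixed by two given flips. At `K = -1` the zeros
-- `0` and `-μ` of `z` merge, and the further point coincides with the origin. At `K = 0` that point
-- disappears, since its coordinate `a` would have to solve `K a = μ` with `μ = -2`. The condition
-- `K ≠ ±2` says that `κ ν = K² - 4` is nonzero. This keeps the zeros `κ` and `-μ` apart, because
-- `κ + μ = κ ν`, and it makes the constant rows of `disc` nonzero.

𝟙 : {P : Set} → Dec P → ℤ
𝟙 P? = if does P? then 1ℤ else 0ℤ

𝟙-yes : {P : Set} (P? : Dec P) → P → 𝟙 P? ≡ 1ℤ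
𝟙-yes (yes _) _ = refl
𝟙-yes (no ¬p) p = ⊥-elim (¬p p)

𝟙-no : {P : Set} (P? : Dec P) → ¬ P → 𝟙 P? ≡ 0ℤ
𝟙-no (yes p) ¬p = ⊥-elim (¬p p)
𝟙-no (no _)  _  = refl

𝟙-cong : {P Q : Set} (P? : Dec P) (Q? : Dec Q) → (P → Q) → (Q → P) → 𝟙 P? ≡ 𝟙 Q?
𝟙-cong (yes p) Q? f g = sym (𝟙-yes Q? (f p))
𝟙-cong (no ¬p) Q? f g = sym (𝟙-no Q? (¬p ∘ g))

𝟙-× : {P Q : Set} (P? : Dec P) (Q? : Dec Q) → 𝟙 (P? ×-dec Q?) ≡ 𝟙 P? * 𝟙 Q?
𝟙-× (yes _) Q? = sym (ℤ.*-identityˡ (𝟙 Q?))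
𝟙-× (no _)  Q? = sym (ℤ.*-zeroˡ (𝟙 Q?))

-- Integer sums over `Fin n`.

sum-const : ∀ n c → sum {n} (λ _ → c) ≡ + n * c
sum-const zero    c = sym (ℤ.*-zeroˡ c)
sum-const (suc n) c = trans (cong (λ t → c + t) (sum-const n c)) (sym (ℤ.suc-* (+ n) c))

sum-𝟙 : ∀ {n} (k : Fin n) (f : Fin n → ℤ) → sum (λ x → 𝟙 (x ≟ᶠ k) * f x) ≡ f k
sum-𝟙 {suc n} zero f = begin
  1ℤ * f zero + sum (λ x → 0ℤ * f (suc x))  ≡⟨ cong₂ _+_ (ℤ.*-identityˡ (f zero)) (sum-cong-≗ λ x → ℤ.*-zeroˡ (f (suc x))) ⟩
  f zero + sum {n} (λ _ → 0ℤ)               ≡⟨ cong (λ t → f zero + t) (trans (sum-const n 0ℤ) (ℤ.*-zeroʳ (+ n))) ⟩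
  f zero + 0ℤ                               ≡⟨ ℤ.+-identityʳ (f zero) ⟩
  f zero                                    ∎
  where open ≡-Reasoning
sum-𝟙 (suc k) f = begin
  0ℤ * f zero + sum (λ x → 𝟙 (x ≟ᶠ k) * f (suc x))  ≡⟨ cong₂ _+_ (ℤ.*-zeroˡ (f zero)) (sum-𝟙 k (f ∘ suc)) ⟩
  0ℤ + f (suc k)                                    ≡⟨ ℤ.+-identityˡ (f (suc k)) ⟩
  f (suc k)                                         ∎
  where open ≡-Reasoning

sum≤0 : ∀ {n} (f : Fin n → ℤ) → (∀ x → f x ≤ 0ℤ) → sum f ≤ 0ℤ
sum≤0 {zero}  f f≤0 = ℤ.≤-refl
sum≤0 {suc n} f f≤0 = ℤ.+-mono-≤ (f≤0 zero) (sum≤0 (f ∘ suc) (f≤0 ∘ suc))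

≤0∧+≡0⇒≡0 : ∀ {i j} → i ≤ 0ℤ → j ≤ 0ℤ → i + j ≡ 0ℤ → i ≡ 0ℤ × j ≡ 0ℤ
≤0∧+≡0⇒≡0 {i} {j} i≤0 j≤0 eq = ℤ.≤-antisym i≤0 0≤i , ℤ.≤-antisym j≤0 0≤j
  where
  0≤i : 0ℤ ≤ i
  0≤i = ℤ.≤-trans (ℤ.≤-reflexive (sym eq)) (ℤ.≤-trans (ℤ.+-monoʳ-≤ i j≤0) (ℤ.≤-reflexive (ℤ.+-identityʳ i)))
  0≤j : 0ℤ ≤ j
  0≤j = ℤ.≤-trans (ℤ.≤-reflexive (sym eq)) (ℤ.≤-trans (ℤ.+-monoˡ-≤ j i≤0) (ℤ.≤-reflexive (ℤ.+-identityˡ j)))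

sum-≤0-≡0 : ∀ {n} (f : Fin n → ℤ) → (∀ x → f x ≤ 0ℤ) → sum f ≡ 0ℤ → ∀ x → f x ≡ 0ℤ
sum-≤0-≡0 f f≤0 eq zero    = proj₁ (≤0∧+≡0⇒≡0 (f≤0 zero) (sum≤0 (f ∘ suc) (f≤0 ∘ suc)) eq)
sum-≤0-≡0 f f≤0 eq (suc x) = sum-≤0-≡0 (f ∘ suc) (f≤0 ∘ suc)
  (proj₂ (≤0∧+≡0⇒≡0 (f≤0 zero) (sum≤0 (f ∘ suc) (f≤0 ∘ suc)) eq)) x

sum-neg : ∀ {n} (f : Fin n → ℤ) → sum (λ x → - f x) ≡ - sum f
sum-neg f = begin
  sum (λ x → - f x)       ≡⟨ sum-cong-≗ (λ x → sym (ℤ.-1*i≡-i (f x))) ⟩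
  sum (λ x → -1ℤ * f x)   ≡⟨ *-distribˡ-sum -1ℤ f ⟨
  -1ℤ * sum f             ≡⟨ ℤ.-1*i≡-i (sum f) ⟩
  - sum f                 ∎
  where open ≡-Reasoning

∑-distrib-minus : ∀ {n} (f g : Fin n → ℤ) → sum (λ x → f x - g x) ≡ sum f - sum g
∑-distrib-minus f g = trans (∑-distrib-+ f (λ x → - g x)) (cong (λ u → sum f + u) (sum-neg g))

-- Every function of the number of ones among e₁, e₂, e₃ ∈ {0, 1} that vanishes at 0 has this form.
weigh : (x y z e₁ e₂ e₃ : ℤ) → ℤ
weigh x y z e₁ e₂ e₃ = x * (e₁ + e₂ + e₃) + y * (e₁ * e₂ + e₁ * e₃ + e₂ * e₃) + z * (e₁ * e₂ * e₃)

weigh-cong : ∀ x y z {e₁ e₂ e₃ e₁′ e₂′ e₃′} → e₁ ≡ e₁′ → e₂ ≡ e₂′ → e₃ ≡ e₃′ →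
  weigh x y z e₁ e₂ e₃ ≡ weigh x y z e₁′ e₂′ e₃′
weigh-cong x y z refl refl refl = refl

-- The ring 𝔽 p of the statement, with its operations kept abstract so that the ring solver
-- never unfolds modular arithmetic.
record OddField (p : ℕ) : Set where
  infix  8 -ᶠ_
  infixl 7 _*ᶠ_
  infixl 6 _+ᶠ_
  field
    _+ᶠ_ _*ᶠ_         : Fin p → Fin p → Fin p
    -ᶠ_               : Fin p → Fin p
    ι                 : ℤ → Fin p
    isCommutativeRing : IsCommutativeRing _≡_ _+ᶠ_ _*ᶠ_ -ᶠ_ (ι 0ℤ) (ι 1ℤ)
    ι-+               : ∀ i j → ι (i + j) ≡ ι i +ᶠ ι j
    ι-*               : ∀ i j → ι (i * j) ≡ ι i *ᶠ ι j
    ι-neg             : ∀ i → ι (- i) ≡ -ᶠ ι i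
    inverse           : ∀ x → x ≢ ι 0ℤ → ∃ λ y → x *ᶠ y ≡ ι 1ℤ
    2≢0               : ι (+ 2) ≢ ι 0ℤ

  commutativeRing : CommutativeRing 0ℓ 0ℓ
  commutativeRing = record { isCommutativeRing = isCommutativeRing }

  0ᶠ 1ᶠ : Fin p
  0ᶠ = ι 0ℤ
  1ᶠ = ι 1ℤ

  -- Spelled exactly like the `σ` of the statement, so that the two agree by `refl` once the
  -- operations are instantiated.
  σ : Fin p → ℤ
  σ a = if does (a ≟ᶠ 0ᶠ) then 0ℤ
        else if does (any? λ b → b *ᶠ b ≟ᶠ a) then 1ℤ
        else -1ℤ

  δ : Fin p → ℤ
  δ x = 𝟙 (x ≟ᶠ 0ᶠ)

-- Zero counts and character sums of quadratics in odd characteristic.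

module QuadraticSums {p : ℕ} (F : OddField p) where
  open OddField F

  morphism : ℤ.+-*-rawRing -Raw-AlmostCommutative⟶ fromCommutativeRing commutativeRing
  morphism = record
    { ⟦_⟧    = ι
    ; +-homo = ι-+
    ; *-homo = ι-*
    ; -‿homo = ι-neg
    ; 0-homo = refl
    ; 1-homo = refl
    }

  -- Coefficients are compared as integers. Two that agree only modulo `p` yield `nothing`, so
  -- `solve` proves the identities that already hold with integer coefficients.
  ι-≟ : ∀ i j → Maybe (ι i ≡ ι j)
  ι-≟ i j with i ℤ.≟ j
  ... | yes i≡j = just (cong ι i≡j)
  ... | no  _   = nothing

  open RingSolver ℤ.+-*-rawRing (fromCommutativeRing commutativeRing) morphism ι-≟ public
    using (solve; con; _:+_; _:*_; _:-_; :-_; _:=_)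

  -- The factorisation is an argument so that a `solve` identity can exhibit `x` as a multiple of a
  -- term known to vanish.
  multiple≡0 : ∀ {x y} z → x ≡ z *ᶠ y → y ≡ 0ᶠ → x ≡ 0ᶠ
  multiple≡0 z x≡zy refl = trans x≡zy (solve 1 (λ z → z :* con 0ℤ := con 0ℤ) refl z)

  x*y≡0⇒x≡0∨y≡0 : ∀ x y → x *ᶠ y ≡ 0ᶠ → x ≡ 0ᶠ ⊎ y ≡ 0ᶠ
  x*y≡0⇒x≡0∨y≡0 x y xy≡0 with x ≟ᶠ 0ᶠ
  ... | yes x≡0 = inj₁ x≡0
  ... | no  x≢0 with x⁻¹ , inv ← inverse x x≢0 = inj₂ (begin
    y                  ≡⟨ solve 1 (λ y → y := con 1ℤ :* y) refl y ⟩
    1ᶠ *ᶠ y            ≡⟨ cong (_*ᶠ y) inv ⟨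
    x *ᶠ x⁻¹ *ᶠ y      ≡⟨ solve 3 (λ x i y → x :* i :* y := i :* (x :* y)) refl x x⁻¹ y ⟩
    x⁻¹ *ᶠ (x *ᶠ y)    ≡⟨ multiple≡0 x⁻¹ refl xy≡0 ⟩
    0ᶠ                 ∎)
    where open ≡-Reasoning

  *-≢0 : ∀ {x y} → x ≢ 0ᶠ → y ≢ 0ᶠ → x *ᶠ y ≢ 0ᶠ
  *-≢0 {x} {y} x≢0 y≢0 xy≡0 with x*y≡0⇒x≡0∨y≡0 x y xy≡0
  ... | inj₁ x≡0 = x≢0 x≡0
  ... | inj₂ y≡0 = y≢0 y≡0

  *-cancel-0 : ∀ {x y} → x ≢ 0ᶠ → x *ᶠ y ≡ 0ᶠ → y ≡ 0ᶠ
  *-cancel-0 {x} {y} x≢0 xy≡0 with x*y≡0⇒x≡0∨y≡0 x y xy≡0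
  ... | inj₁ x≡0 = ⊥-elim (x≢0 x≡0)
  ... | inj₂ y≡0 = y≡0

  -‿≡0⇒≡ : ∀ {x y} → x +ᶠ -ᶠ y ≡ 0ᶠ → x ≡ y
  -‿≡0⇒≡ {x} {y} x-y≡0 = begin
    x                  ≡⟨ solve 2 (λ x y → x := x :- y :+ y) refl x y ⟩
    x +ᶠ -ᶠ y +ᶠ y     ≡⟨ cong (_+ᶠ y) x-y≡0 ⟩
    0ᶠ +ᶠ y            ≡⟨ solve 1 (λ y → con 0ℤ :+ y := y) refl y ⟩
    y                  ∎
    where open ≡-Reasoning

  ≡⇒-‿≡0 : ∀ {x y} → x ≡ y → x +ᶠ -ᶠ y ≡ 0ᶠ
  ≡⇒-‿≡0 {x} refl = solve 1 (λ x → x :- x := con 0ℤ) refl x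

  1≢0 : 1ᶠ ≢ 0ᶠ
  1≢0 1≡0 = 2≢0 (multiple≡0 (ι (+ 2)) (solve 0 (con (+ 2) := con (+ 2) :* con 1ℤ) refl) 1≡0)

  4≢0 : ι (+ 4) ≢ 0ᶠ
  4≢0 4≡0 = *-≢0 2≢0 2≢0 (trans (solve 0 (con (+ 2) :* con (+ 2) := con (+ 4)) refl) 4≡0)

  16≢0 : ι (+ 16) ≢ 0ᶠ
  16≢0 16≡0 = *-≢0 4≢0 4≢0 (trans (solve 0 (con (+ 4) :* con (+ 4) := con (+ 16)) refl) 16≡0)

  δ-≡0 : ∀ {x} → x ≡ 0ᶠ → δ x ≡ 1ℤ
  δ-≡0 {x} = 𝟙-yes (x ≟ᶠ 0ᶠ)

  δ-≢0 : ∀ {x} → x ≢ 0ᶠ → δ x ≡ 0ℤ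
  δ-≢0 {x} = 𝟙-no (x ≟ᶠ 0ᶠ)

  δ-cong : ∀ {x y} → (x ≡ 0ᶠ → y ≡ 0ᶠ) → (y ≡ 0ᶠ → x ≡ 0ᶠ) → δ x ≡ δ y
  δ-cong {x} {y} = 𝟙-cong (x ≟ᶠ 0ᶠ) (y ≟ᶠ 0ᶠ)

  sum-affine : ∀ {a} b → a ≢ 0ᶠ → (f : Fin p → ℤ) → sum (λ x → f (a *ᶠ x +ᶠ b)) ≡ sum f
  sum-affine {a} b a≢0 f with a⁻¹ , inv ← inverse a a≢0 =
    sym (∑-permute f (permutation (λ x → a *ᶠ x +ᶠ b) (λ y → a⁻¹ *ᶠ (y +ᶠ -ᶠ b)) invˡ invʳ))
    where
    open ≡-Reasoning
    invˡ : ∀ y → a *ᶠ (a⁻¹ *ᶠ (y +ᶠ -ᶠ b)) +ᶠ b ≡ y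
    invˡ y = begin
      a *ᶠ (a⁻¹ *ᶠ (y +ᶠ -ᶠ b)) +ᶠ b    ≡⟨ solve 4 (λ a i y b → a :* (i :* (y :- b)) :+ b := a :* i :* (y :- b) :+ b) refl a a⁻¹ y b ⟩
      a *ᶠ a⁻¹ *ᶠ (y +ᶠ -ᶠ b) +ᶠ b      ≡⟨ cong (λ u → u *ᶠ (y +ᶠ -ᶠ b) +ᶠ b) inv ⟩
      1ᶠ *ᶠ (y +ᶠ -ᶠ b) +ᶠ b            ≡⟨ solve 2 (λ y b → con 1ℤ :* (y :- b) :+ b := y) refl y b ⟩
      y                                 ∎
    invʳ : ∀ x → a⁻¹ *ᶠ (a *ᶠ x +ᶠ b +ᶠ -ᶠ b) ≡ x
    invʳ x = begin
      a⁻¹ *ᶠ (a *ᶠ x +ᶠ b +ᶠ -ᶠ b)      ≡⟨ solve 4 (λ a i x b → i :* (a :* x :+ b :- b) := a :* i :* x) refl a a⁻¹ x b ⟩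
      a *ᶠ a⁻¹ *ᶠ x                     ≡⟨ cong (_*ᶠ x) inv ⟩
      1ᶠ *ᶠ x                           ≡⟨ solve 1 (λ x → con 1ℤ :* x := x) refl x ⟩
      x                                 ∎

  sum-shift : ∀ b (f : Fin p → ℤ) → sum (λ x → f (x +ᶠ b)) ≡ sum f
  sum-shift b f = trans
    (sum-cong-≗ λ x → cong f (solve 2 (λ x b → x :+ b := con 1ℤ :* x :+ b) refl x b))
    (sum-affine b 1≢0 f)

  sum-δ* : ∀ k (f : Fin p → ℤ) → sum (λ x → δ (x +ᶠ -ᶠ k) * f x) ≡ f k
  sum-δ* k f = trans
    (sum-cong-≗ λ x → cong (_* f x) (𝟙-cong (x +ᶠ -ᶠ k ≟ᶠ 0ᶠ) (x ≟ᶠ k) -‿≡0⇒≡ ≡⇒-‿≡0))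
    (sum-𝟙 k f)

  sum-δ- : ∀ k → sum (λ x → δ (x +ᶠ -ᶠ k)) ≡ 1ℤ
  sum-δ- k = trans (sum-cong-≗ λ x → sym (ℤ.*-identityʳ (δ (x +ᶠ -ᶠ k)))) (sum-δ* k (λ _ → 1ℤ))

  sum-δ : sum δ ≡ 1ℤ
  sum-δ = trans (sym (sum-shift (-ᶠ 0ᶠ) δ)) (sum-δ- 0ᶠ)

  sum-δ-linear : ∀ {a} b → a ≢ 0ᶠ → sum (λ x → δ (a *ᶠ x +ᶠ b)) ≡ 1ℤ
  sum-δ-linear b a≢0 = trans (sum-affine b a≢0 δ) sum-δ

  -- The quadratic character and its multiplicativity.

  data QuadraticClass (a : Fin p) : Set where
    null      : a ≡ 0ᶠ → σ a ≡ 0ℤ → QuadraticClass a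
    square    : ∀ b → b ≢ 0ᶠ → a ≡ b *ᶠ b → σ a ≡ 1ℤ → QuadraticClass a
    nonsquare : (∀ b → a ≢ b *ᶠ b) → σ a ≡ -1ℤ → QuadraticClass a

  x*x≡0⇒x≡0 : ∀ {x} → x *ᶠ x ≡ 0ᶠ → x ≡ 0ᶠ
  x*x≡0⇒x≡0 {x} xx≡0 with x*y≡0⇒x≡0∨y≡0 x x xx≡0
  ... | inj₁ x≡0 = x≡0
  ... | inj₂ x≡0 = x≡0

  classify : ∀ a → QuadraticClass a
  classify a with a ≟ᶠ 0ᶠ in eq₀ | any? (λ b → b *ᶠ b ≟ᶠ a) in eq
  ... | yes a≡0 | _ = null a≡0 σa
    where
    σa : σ a ≡ 0ℤ
    σa rewrite eq₀ = refl
  ... | no a≢0 | yes (b , bb≡a) = square b b≢0 (sym bb≡a) σa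
    where
    b≢0 : b ≢ 0ᶠ
    b≢0 b≡0 = a≢0 (trans (sym bb≡a) (multiple≡0 b refl b≡0))
    σa : σ a ≡ 1ℤ
    σa rewrite eq₀ | eq = refl
  ... | no a≢0 | no ¬∃ = nonsquare (λ b a≡bb → ¬∃ (b , sym a≡bb)) σa
    where
    σa : σ a ≡ -1ℤ
    σa rewrite eq₀ | eq = refl

  σ-zero : ∀ {a} → a ≡ 0ᶠ → σ a ≡ 0ℤ
  σ-zero {a} a≡0 with classify a
  ... | null _ σa          = σa
  ... | square b b≢0 a≡bb _ = ⊥-elim (*-≢0 b≢0 b≢0 (trans (sym a≡bb) a≡0))
  ... | nonsquare a≢bb _   = ⊥-elim (a≢bb 0ᶠ (trans a≡0 (solve 0 (con 0ℤ := con 0ℤ :* con 0ℤ) refl)))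

  σ-square : ∀ {a} b → b ≢ 0ᶠ → a ≡ b *ᶠ b → σ a ≡ 1ℤ
  σ-square {a} b b≢0 a≡bb with classify a
  ... | null a≡0 _       = ⊥-elim (*-≢0 b≢0 b≢0 (trans (sym a≡bb) a≡0))
  ... | square _ _ _ σa  = σa
  ... | nonsquare a≢bb _ = ⊥-elim (a≢bb b a≡bb)

  σ-nonsquare : ∀ {a} → (∀ b → a ≢ b *ᶠ b) → σ a ≡ -1ℤ
  σ-nonsquare {a} a≢bb with classify a
  ... | null a≡0 _        = ⊥-elim (a≢bb 0ᶠ (trans a≡0 (solve 0 (con 0ℤ := con 0ℤ :* con 0ℤ) refl)))
  ... | square b _ a≡bb _ = ⊥-elim (a≢bb b a≡bb)
  ... | nonsquare _ σa    = σa

  σ≤1 : ∀ a → σ a ≤ 1ℤ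
  σ≤1 a with classify a
  ... | null _ σa       = ℤ.≤-trans (ℤ.≤-reflexive σa) (+≤+ z≤n)
  ... | square _ _ _ σa = ℤ.≤-reflexive σa
  ... | nonsquare _ σa  = ℤ.≤-trans (ℤ.≤-reflexive σa) -≤+

  sum-δ-x²-d : ∀ d → sum (λ x → δ (x *ᶠ x +ᶠ -ᶠ d)) ≡ 1ℤ + σ d
  sum-δ-x²-d d with classify d
  ... | null refl σd = begin
    sum (λ x → δ (x *ᶠ x +ᶠ -ᶠ 0ᶠ))   ≡⟨ sum-cong-≗ (λ x → δ-cong {x *ᶠ x +ᶠ -ᶠ 0ᶠ} {x} (x*x≡0⇒x≡0 ∘ -‿≡0⇒≡) (≡⇒-‿≡0 ∘ multiple≡0 x refl)) ⟩
    sum δ                             ≡⟨ sum-δ ⟩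
    1ℤ + 0ℤ                           ≡⟨ cong (λ t → 1ℤ + t) σd ⟨
    1ℤ + σ 0ᶠ                         ∎
    where open ≡-Reasoning
  ... | nonsquare d≢bb σd = begin
    sum (λ x → δ (x *ᶠ x +ᶠ -ᶠ d))    ≡⟨ sum-cong-≗ (λ x → δ-≢0 (d≢bb x ∘ sym ∘ -‿≡0⇒≡)) ⟩
    sum {p} (λ _ → 0ℤ)                ≡⟨ trans (sum-const p 0ℤ) (ℤ.*-zeroʳ (+ p)) ⟩
    1ℤ + -1ℤ                          ≡⟨ cong (λ t → 1ℤ + t) σd ⟨
    1ℤ + σ d                          ∎
    where open ≡-Reasoning
  ... | square b b≢0 refl σd = begin
    sum (λ x → δ (x *ᶠ x +ᶠ -ᶠ (b *ᶠ b)))               ≡⟨ sum-cong-≗ split ⟩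
    sum (λ x → δ (x +ᶠ -ᶠ b) + δ (x +ᶠ b))              ≡⟨ ∑-distrib-+ (λ x → δ (x +ᶠ -ᶠ b)) (λ x → δ (x +ᶠ b)) ⟩
    sum (λ x → δ (x +ᶠ -ᶠ b)) + sum (λ x → δ (x +ᶠ b))  ≡⟨ cong₂ _+_ (sum-δ- b) (trans (sum-shift b δ) sum-δ) ⟩
    1ℤ + 1ℤ                                             ≡⟨ cong (λ t → 1ℤ + t) σd ⟨
    1ℤ + σ (b *ᶠ b)                                     ∎
    where
    open ≡-Reasoning
    factor : ∀ x → x *ᶠ x +ᶠ -ᶠ (b *ᶠ b) ≡ (x +ᶠ -ᶠ b) *ᶠ (x +ᶠ b)
    factor x = solve 2 (λ x b → x :* x :- b :* b := (x :- b) :* (x :+ b)) refl x b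
    split : ∀ x → δ (x *ᶠ x +ᶠ -ᶠ (b *ᶠ b)) ≡ δ (x +ᶠ -ᶠ b) + δ (x +ᶠ b)
    split x with x +ᶠ -ᶠ b ≟ᶠ 0ᶠ | x +ᶠ b ≟ᶠ 0ᶠ
    ... | yes x≡b | yes x≡-b = ⊥-elim (*-≢0 2≢0 b≢0 (begin
      ι (+ 2) *ᶠ b                  ≡⟨ solve 2 (λ x b → con (+ 2) :* b := (x :+ b) :- (x :- b)) refl x b ⟩
      (x +ᶠ b) +ᶠ -ᶠ (x +ᶠ -ᶠ b)    ≡⟨ ≡⇒-‿≡0 (trans x≡-b (sym x≡b)) ⟩
      0ᶠ                            ∎))
    ... | yes x≡b | no _     = δ-≡0 (multiple≡0 (x +ᶠ b) (solve 2 (λ x b → x :* x :- b :* b := (x :+ b) :* (x :- b)) refl x b) x≡b)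
    ... | no _    | yes x≡-b = δ-≡0 (multiple≡0 (x +ᶠ -ᶠ b) (factor x) x≡-b)
    ... | no x≢b  | no x≢-b  = δ-≢0 (*-≢0 x≢b x≢-b ∘ trans (sym (factor x)))

  -- Solving `sum-δ-x²-d` for `σ d` turns the sum into a count of pairs `(x, d)` with `x² = d`,
  -- minus `p`. Each `x` is a root of exactly one `d`, so there are `p` such pairs.
  sum-σ : sum σ ≡ 0ℤ
  sum-σ = begin
    sum σ                                                   ≡⟨ sum-cong-≗ (λ d → isolate (sum-δ-x²-d d)) ⟩
    sum (λ d → sum (λ x → δ (x *ᶠ x +ᶠ -ᶠ d)) - 1ℤ)         ≡⟨ ∑-distrib-minus (λ d → sum (λ x → δ (x *ᶠ x +ᶠ -ᶠ d))) (λ _ → 1ℤ) ⟩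
    sum (λ d → sum (λ x → δ (x *ᶠ x +ᶠ -ᶠ d))) - sum {p} (λ _ → 1ℤ)
                                                            ≡⟨ cong (_- sum {p} (λ _ → 1ℤ)) (∑-comm (λ d x → δ (x *ᶠ x +ᶠ -ᶠ d))) ⟩
    sum (λ x → sum (λ d → δ (x *ᶠ x +ᶠ -ᶠ d))) - sum {p} (λ _ → 1ℤ)
                                                            ≡⟨ cong (_- sum {p} (λ _ → 1ℤ)) (sum-cong-≗ inner) ⟩
    sum {p} (λ _ → 1ℤ) - sum {p} (λ _ → 1ℤ)                 ≡⟨ ℤ.+-inverseʳ (sum {p} (λ _ → 1ℤ)) ⟩
    0ℤ                                                      ∎
    where
    open ≡-Reasoning
    isolate : ∀ {s t} → s ≡ 1ℤ + t → t ≡ s - 1ℤ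
    isolate {t = t} refl = eq t
      where
      eq : ∀ t → t ≡ 1ℤ + t - 1ℤ
      eq = solve-∀
    inner : ∀ x → sum (λ d → δ (x *ᶠ x +ᶠ -ᶠ d)) ≡ 1ℤ
    inner x = trans
      (sum-cong-≗ λ d → δ-cong {x *ᶠ x +ᶠ -ᶠ d} {d +ᶠ -ᶠ (x *ᶠ x)} (≡⇒-‿≡0 ∘ sym ∘ -‿≡0⇒≡) (≡⇒-‿≡0 ∘ sym ∘ -‿≡0⇒≡))
      (sum-δ- (x *ᶠ x))

  σ-square-* : ∀ c b → c ≢ 0ᶠ → σ (c *ᶠ c *ᶠ b) ≡ σ b
  σ-square-* c b c≢0 with classify b
  ... | null b≡0 σb = trans (σ-zero (multiple≡0 (c *ᶠ c) refl b≡0)) (sym σb)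
  ... | square d d≢0 b≡dd σb = trans
    (σ-square (c *ᶠ d) (*-≢0 c≢0 d≢0)
      (trans (cong (c *ᶠ c *ᶠ_) b≡dd) (solve 2 (λ c d → c :* c :* (d :* d) := c :* d :* (c :* d)) refl c d)))
    (sym σb)
  ... | nonsquare b≢dd σb with c⁻¹ , inv ← inverse c c≢0 = trans (σ-nonsquare ccb≢ee) (sym σb)
    where
    open ≡-Reasoning
    ccb≢ee : ∀ e → c *ᶠ c *ᶠ b ≢ e *ᶠ e
    ccb≢ee e ccb≡ee = b≢dd (c⁻¹ *ᶠ e) (begin
      b                                      ≡⟨ solve 1 (λ b → b := con 1ℤ :* con 1ℤ :* b) refl b ⟩
      1ᶠ *ᶠ 1ᶠ *ᶠ b                          ≡⟨ cong (λ u → u *ᶠ u *ᶠ b) inv ⟨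
      c *ᶠ c⁻¹ *ᶠ (c *ᶠ c⁻¹) *ᶠ b            ≡⟨ solve 3 (λ c i b → c :* i :* (c :* i) :* b := i :* i :* (c :* c :* b)) refl c c⁻¹ b ⟩
      c⁻¹ *ᶠ c⁻¹ *ᶠ (c *ᶠ c *ᶠ b)            ≡⟨ cong (c⁻¹ *ᶠ c⁻¹ *ᶠ_) ccb≡ee ⟩
      c⁻¹ *ᶠ c⁻¹ *ᶠ (e *ᶠ e)                 ≡⟨ solve 2 (λ i e → i :* i :* (e :* e) := i :* e :* (i :* e)) refl c⁻¹ e ⟩
      c⁻¹ *ᶠ e *ᶠ (c⁻¹ *ᶠ e)                 ∎)

  -- Multiplication by a nonsquare a exchanges the classes: every term σ (a x) + σ x is at most
  -- 0, and the terms add up to 0.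
  σ-nonsquare-* : ∀ a → (∀ b → a ≢ b *ᶠ b) → ∀ x → σ (a *ᶠ x) + σ x ≡ 0ℤ
  σ-nonsquare-* a a≢bb = sum-≤0-≡0 (λ x → σ (a *ᶠ x) + σ x) term≤0 (begin
    sum (λ x → σ (a *ᶠ x) + σ x)         ≡⟨ ∑-distrib-+ (λ x → σ (a *ᶠ x)) σ ⟩
    sum (λ x → σ (a *ᶠ x)) + sum σ       ≡⟨ cong (_+ sum σ) (sum-cong-≗ λ x → cong σ (solve 2 (λ a x → a :* x := a :* x :+ con 0ℤ) refl a x)) ⟩
    sum (λ x → σ (a *ᶠ x +ᶠ 0ᶠ)) + sum σ ≡⟨ cong (_+ sum σ) (sum-affine 0ᶠ a≢0 σ) ⟩
    sum σ + sum σ                        ≡⟨ cong₂ _+_ sum-σ sum-σ ⟩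
    0ℤ                                   ∎)
    where
    open ≡-Reasoning
    a≢0 : a ≢ 0ᶠ
    a≢0 a≡0 = a≢bb 0ᶠ (trans a≡0 (solve 0 (con 0ℤ := con 0ℤ :* con 0ℤ) refl))
    term≤0 : ∀ x → σ (a *ᶠ x) + σ x ≤ 0ℤ
    term≤0 x with classify x
    ... | null x≡0 σx = ℤ.≤-reflexive (cong₂ _+_ (σ-zero (multiple≡0 a refl x≡0)) σx)
    ... | square b b≢0 refl σx = ℤ.≤-reflexive (cong₂ _+_
      (trans (cong σ (solve 2 (λ a b → a :* (b :* b) := b :* b :* a) refl a b))
             (trans (σ-square-* b a b≢0) (σ-nonsquare a≢bb)))
      σx)
    ... | nonsquare _ σx = ℤ.+-mono-≤ (σ≤1 (a *ᶠ x)) (ℤ.≤-reflexive σx)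

  -- For a nonsquare `a` the sign comes from `σ (a b) + σ b = 0`, which the vanishing of `sum σ`
  -- forces.
  σ-* : ∀ a b → σ (a *ᶠ b) ≡ σ a * σ b
  σ-* a b with classify a
  ... | null a≡0 σa = begin
    σ (a *ᶠ b)    ≡⟨ σ-zero (multiple≡0 b (solve 2 (λ a b → a :* b := b :* a) refl a b) a≡0) ⟩
    0ℤ * σ b      ≡⟨ cong (_* σ b) σa ⟨
    σ a * σ b     ∎
    where open ≡-Reasoning
  ... | square c c≢0 refl σa = begin
    σ (c *ᶠ c *ᶠ b)     ≡⟨ σ-square-* c b c≢0 ⟩
    σ b                 ≡⟨ ℤ.*-identityˡ (σ b) ⟨
    1ℤ * σ b            ≡⟨ cong (_* σ b) σa ⟨
    σ (c *ᶠ c) * σ b    ∎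
    where open ≡-Reasoning
  ... | nonsquare a≢bb σa = begin
    σ (a *ᶠ b)                ≡⟨ eq (σ (a *ᶠ b)) (σ b) ⟩
    σ (a *ᶠ b) + σ b - σ b    ≡⟨ cong (_- σ b) (σ-nonsquare-* a a≢bb b) ⟩
    0ℤ - σ b                  ≡⟨ eq′ (σ b) ⟩
    -1ℤ * σ b                 ≡⟨ cong (_* σ b) σa ⟨
    σ a * σ b                 ∎
    where
    open ≡-Reasoning
    eq : ∀ s t → s ≡ s + t - t
    eq = solve-∀
    eq′ : ∀ t → 0ℤ - t ≡ -1ℤ * t
    eq′ = solve-∀

  σ*σ≡1 : ∀ {a} → a ≢ 0ᶠ → σ a * σ a ≡ 1ℤ
  σ*σ≡1 {a} a≢0 with classify a
  ... | null a≡0 _      = ⊥-elim (a≢0 a≡0)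
  ... | square _ _ _ σa = cong₂ _*_ σa σa
  ... | nonsquare _ σa  = cong₂ _*_ σa σa

  -- The substitution y = x + u makes y² = x² - k linear in x.
  sum-σ-x²-k : ∀ k → sum (λ x → σ (x *ᶠ x +ᶠ -ᶠ k)) ≡ + p * δ k - 1ℤ
  sum-σ-x²-k k = begin
    sum (λ x → σ (x *ᶠ x +ᶠ -ᶠ k))                        ≡⟨ sum-cong-≗ count ⟩
    sum (λ x → sum (λ u → δ (h u x)) - 1ℤ)                ≡⟨ ∑-distrib-minus (λ x → sum (λ u → δ (h u x))) (λ _ → 1ℤ) ⟩
    sum (λ x → sum (λ u → δ (h u x))) - sum {p} (λ _ → 1ℤ) ≡⟨ cong (_- sum {p} (λ _ → 1ℤ)) (∑-comm (λ x u → δ (h u x))) ⟩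
    sum (λ u → sum (λ x → δ (h u x))) - sum {p} (λ _ → 1ℤ) ≡⟨ cong (_- sum {p} (λ _ → 1ℤ)) (sum-cong-≗ inner) ⟩
    sum (λ u → 1ℤ + δ (u +ᶠ -ᶠ 0ᶠ) * (+ p * δ k - 1ℤ)) - sum {p} (λ _ → 1ℤ)
                                                          ≡⟨ cong (_- sum {p} (λ _ → 1ℤ)) (∑-distrib-+ (λ _ → 1ℤ) (λ u → δ (u +ᶠ -ᶠ 0ᶠ) * (+ p * δ k - 1ℤ))) ⟩
    sum {p} (λ _ → 1ℤ) + sum (λ u → δ (u +ᶠ -ᶠ 0ᶠ) * (+ p * δ k - 1ℤ)) - sum {p} (λ _ → 1ℤ)
                                                          ≡⟨ cong (λ s → sum {p} (λ _ → 1ℤ) + s - sum {p} (λ _ → 1ℤ)) (sum-δ* 0ᶠ (λ _ → + p * δ k - 1ℤ)) ⟩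
    sum {p} (λ _ → 1ℤ) + (+ p * δ k - 1ℤ) - sum {p} (λ _ → 1ℤ) ≡⟨ cancel (sum {p} (λ _ → 1ℤ)) (+ p * δ k - 1ℤ) ⟩
    + p * δ k - 1ℤ                                        ∎
    where
    open ≡-Reasoning
    cancel : ∀ s t → s + t - s ≡ t
    cancel = solve-∀
    h : Fin p → Fin p → Fin p
    h u x = ι (+ 2) *ᶠ u *ᶠ x +ᶠ (u *ᶠ u +ᶠ k)
    count : ∀ x → σ (x *ᶠ x +ᶠ -ᶠ k) ≡ sum (λ u → δ (h u x)) - 1ℤ
    count x = begin
      σ (x *ᶠ x +ᶠ -ᶠ k)                                                  ≡⟨ eq (σ (x *ᶠ x +ᶠ -ᶠ k)) ⟩
      1ℤ + σ (x *ᶠ x +ᶠ -ᶠ k) - 1ℤ                                        ≡⟨ cong (_- 1ℤ) (sum-δ-x²-d (x *ᶠ x +ᶠ -ᶠ k)) ⟨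
      sum (λ y → δ (y *ᶠ y +ᶠ -ᶠ (x *ᶠ x +ᶠ -ᶠ k))) - 1ℤ                  ≡⟨ cong (_- 1ℤ) (sum-shift x (λ y → δ (y *ᶠ y +ᶠ -ᶠ (x *ᶠ x +ᶠ -ᶠ k)))) ⟨
      sum (λ u → δ ((u +ᶠ x) *ᶠ (u +ᶠ x) +ᶠ -ᶠ (x *ᶠ x +ᶠ -ᶠ k))) - 1ℤ    ≡⟨ cong (_- 1ℤ) (sum-cong-≗ λ u → cong δ (solve 3 (λ u x k →
                                                                                 (u :+ x) :* (u :+ x) :- (x :* x :- k) := con (+ 2) :* u :* x :+ (u :* u :+ k)) refl u x k)) ⟩
      sum (λ u → δ (h u x)) - 1ℤ                                          ∎
      where
      eq : ∀ t → t ≡ 1ℤ + t - 1ℤ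
      eq = solve-∀
    -- As a function of `x`, `h u` is affine with slope `2u`, so it has one zero unless `u = 0`,
    -- where it is the constant `k`. The condition is written `u - 0` to fit `sum-δ*`.
    inner : ∀ u → sum (λ x → δ (h u x)) ≡ 1ℤ + δ (u +ᶠ -ᶠ 0ᶠ) * (+ p * δ k - 1ℤ)
    inner u with u +ᶠ -ᶠ 0ᶠ ≟ᶠ 0ᶠ
    ... | yes u≡0 = begin
      sum (λ x → δ (h u x))            ≡⟨ sum-cong-≗ (λ x → cong δ (trans (cong (λ v → h v x) (-‿≡0⇒≡ u≡0)) (solve 2 (λ k x → con (+ 2) :* con 0ℤ :* x :+ (con 0ℤ :* con 0ℤ :+ k) := k) refl k x))) ⟩
      sum {p} (λ _ → δ k)              ≡⟨ sum-const p (δ k) ⟩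
      + p * δ k                        ≡⟨ eq (+ p * δ k) ⟩
      1ℤ + 1ℤ * (+ p * δ k - 1ℤ)       ∎
      where
      eq : ∀ t → t ≡ 1ℤ + 1ℤ * (t - 1ℤ)
      eq = solve-∀
    ... | no u≢0 = trans (sum-δ-linear (u *ᶠ u +ᶠ k) (*-≢0 2≢0 (u≢0 ∘ ≡⇒-‿≡0)))
                         (sym (trans (cong (λ t → 1ℤ + t) (ℤ.*-zeroˡ (+ p * δ k - 1ℤ))) refl))

  -- General quadratics, by completing the square, and their degenerate forms.

  quadratic : (α β γ x : Fin p) → Fin p
  quadratic α β γ x = α *ᶠ (x *ᶠ x) +ᶠ β *ᶠ x +ᶠ γ

  discriminant : (α β γ : Fin p) → Fin p
  discriminant α β γ = β *ᶠ β +ᶠ -ᶠ (ι (+ 4) *ᶠ (α *ᶠ γ))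

  -- The factor 4 is kept as `2 * 2` so that `σ-square-*` can remove it.
  complete-square : ∀ α β γ x → ι (+ 2) *ᶠ ι (+ 2) *ᶠ (α *ᶠ quadratic α β γ x) ≡
    (ι (+ 2) *ᶠ α *ᶠ x +ᶠ β) *ᶠ (ι (+ 2) *ᶠ α *ᶠ x +ᶠ β) +ᶠ -ᶠ discriminant α β γ
  complete-square = solve 4 (λ α β γ x →
    con (+ 2) :* con (+ 2) :* (α :* (α :* (x :* x) :+ β :* x :+ γ)) :=
    (con (+ 2) :* α :* x :+ β) :* (con (+ 2) :* α :* x :+ β) :- (β :* β :- con (+ 4) :* (α :* γ))) refl

  sum-δ-quadratic : ∀ {α} β γ → α ≢ 0ᶠ → sum (λ x → δ (quadratic α β γ x)) ≡ 1ℤ + σ (discriminant α β γ)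
  sum-δ-quadratic {α} β γ α≢0 = begin
    sum (λ x → δ (quadratic α β γ x))                      ≡⟨ sum-cong-≗ (λ x → δ-cong {quadratic α β γ x} {s x}
                                                                (λ q≡0 → trans (sym (complete-square α β γ x)) (multiple≡0 _ refl (multiple≡0 α refl q≡0)))
                                                                (λ s≡0 → *-cancel-0 α≢0 (*-cancel-0 (*-≢0 2≢0 2≢0) (trans (complete-square α β γ x) s≡0)))) ⟩
    sum (λ x → δ (s x))                                    ≡⟨ sum-affine β (*-≢0 2≢0 α≢0) (λ y → δ (y *ᶠ y +ᶠ -ᶠ discriminant α β γ)) ⟩
    sum (λ y → δ (y *ᶠ y +ᶠ -ᶠ discriminant α β γ))        ≡⟨ sum-δ-x²-d (discriminant α β γ) ⟩
    1ℤ + σ (discriminant α β γ)                            ∎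
    where
    open ≡-Reasoning
    s : Fin p → Fin p
    s x = (ι (+ 2) *ᶠ α *ᶠ x +ᶠ β) *ᶠ (ι (+ 2) *ᶠ α *ᶠ x +ᶠ β) +ᶠ -ᶠ discriminant α β γ

  -- Since `σ α` is its own inverse, it can be traded for a factor `α` under `σ`. Multiplying
  -- further by the square 4 leaves the completed square in the affine variable `2αx + β`.
  sum-σ-quadratic : ∀ {α} β γ → α ≢ 0ᶠ →
    sum (λ x → σ (quadratic α β γ x)) ≡ σ α * (+ p * δ (discriminant α β γ) - 1ℤ)
  sum-σ-quadratic {α} β γ α≢0 = begin
    sum (λ x → σ (quadratic α β γ x))                      ≡⟨ sum-cong-≗ term ⟩
    sum (λ x → σ α * σ (s x))                              ≡⟨ *-distribˡ-sum (σ α) (λ x → σ (s x)) ⟨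
    σ α * sum (λ x → σ (s x))                              ≡⟨ cong (σ α *_) (sum-affine β (*-≢0 2≢0 α≢0) (λ y → σ (y *ᶠ y +ᶠ -ᶠ discriminant α β γ))) ⟩
    σ α * sum (λ y → σ (y *ᶠ y +ᶠ -ᶠ discriminant α β γ))  ≡⟨ cong (σ α *_) (sum-σ-x²-k (discriminant α β γ)) ⟩
    σ α * (+ p * δ (discriminant α β γ) - 1ℤ)              ∎
    where
    open ≡-Reasoning
    s : Fin p → Fin p
    s x = (ι (+ 2) *ᶠ α *ᶠ x +ᶠ β) *ᶠ (ι (+ 2) *ᶠ α *ᶠ x +ᶠ β) +ᶠ -ᶠ discriminant α β γ
    term : ∀ x → σ (quadratic α β γ x) ≡ σ α * σ (s x)
    term x = begin
      σ (quadratic α β γ x)                     ≡⟨ ℤ.*-identityˡ (σ (quadratic α β γ x)) ⟨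
      1ℤ * σ (quadratic α β γ x)                ≡⟨ cong (_* σ (quadratic α β γ x)) (σ*σ≡1 α≢0) ⟨
      σ α * σ α * σ (quadratic α β γ x)         ≡⟨ ℤ.*-assoc (σ α) (σ α) _ ⟩
      σ α * (σ α * σ (quadratic α β γ x))       ≡⟨ cong (σ α *_) (σ-* α (quadratic α β γ x)) ⟨
      σ α * σ (α *ᶠ quadratic α β γ x)          ≡⟨ cong (σ α *_) (σ-square-* (ι (+ 2)) _ 2≢0) ⟨
      σ α * σ (ι (+ 2) *ᶠ ι (+ 2) *ᶠ (α *ᶠ quadratic α β γ x)) ≡⟨ cong (λ u → σ α * σ u) (complete-square α β γ x) ⟩
      σ α * σ (s x)                             ∎

  quadratic-≡ : ∀ {α β} γ x → α ≡ 0ᶠ → quadratic α β γ x ≡ β *ᶠ x +ᶠ γ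
  quadratic-≡ {β = β} γ x refl = solve 3 (λ β γ x → con 0ℤ :* (x :* x) :+ β :* x :+ γ := β :* x :+ γ) refl β γ x

  linear-≡ : ∀ {β} γ x → β ≡ 0ᶠ → β *ᶠ x +ᶠ γ ≡ γ
  linear-≡ γ x refl = solve 2 (λ γ x → con 0ℤ :* x :+ γ := γ) refl γ x

  -- Here and in `sum-constant` the summand is arbitrary, because the degenerate rows are summed
  -- once with `σ`, for the vertices, and once with `δ`, for the fixed points.
  sum-linear : ∀ {α β} γ → α ≡ 0ᶠ → β ≢ 0ᶠ → (f : Fin p → ℤ) → sum (λ x → f (quadratic α β γ x)) ≡ sum f
  sum-linear γ α≡0 β≢0 f = trans (sum-cong-≗ λ x → cong f (quadratic-≡ γ x α≡0)) (sum-affine γ β≢0 f)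

  sum-constant : ∀ {α β} γ → α ≡ 0ᶠ → β ≡ 0ᶠ → (f : Fin p → ℤ) → sum (λ x → f (quadratic α β γ x)) ≡ + p * f γ
  sum-constant γ α≡0 β≡0 f = trans
    (sum-cong-≗ λ x → cong f (trans (quadratic-≡ γ x α≡0) (linear-≡ γ x β≡0)))
    (sum-const p (f γ))

-- The discriminant `disc b c` and its character sums over `c`.

module ShiftedSurface {p : ℕ} (F : OddField p) (K : Fin p)
  (K≢2 : K ≢ OddField.ι F (+ 2)) (K≢-2 : K ≢ OddField.ι F (- (+ 2))) where
  open OddField F
  open QuadraticSums F

  -- `κ` and `ν` are the values of `b` at which `disc b c` loses its term in `c²`. The zeros of the
  -- discriminant of `disc b` are `0`, `κ` and `-μ`.
  κ ν μ : Fin p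
  κ  = K +ᶠ -ᶠ ι (+ 2)
  ν = K +ᶠ ι (+ 2)
  μ  = κ *ᶠ (K +ᶠ 1ᶠ)

  κ≢0 : κ ≢ 0ᶠ
  κ≢0 = K≢2 ∘ -‿≡0⇒≡

  ν≢0 : ν ≢ 0ᶠ
  ν≢0 ν≡0 = K≢-2 (-‿≡0⇒≡ (trans (solve 1 (λ K → K :- con (- (+ 2)) := K :+ con (+ 2)) refl K) ν≡0))

  tr nm disc : Fin p → Fin p → Fin p
  tr b c   = K *ᶠ (b +ᶠ c) +ᶠ -ᶠ (b *ᶠ c)
  nm b c   = b *ᶠ b +ᶠ c *ᶠ c +ᶠ K *ᶠ (b *ᶠ c)
  disc b c = discriminant 1ᶠ (tr b c) (nm b c)

  -- In the coordinates shifted by K, the surface is q = 0, and ℓ a b c = 0 means that the flip of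
  -- the coordinate a fixes the point.
  q ℓ : Fin p → Fin p → Fin p → Fin p
  q a b c = quadratic 1ᶠ (tr b c) (nm b c) a
  ℓ a b c = ι (+ 2) *ᶠ a +ᶠ tr b c

  -- A, B, G are the coefficients of disc b as a quadratic in c; z has the zeros of its discriminant.
  A B G z : Fin p → Fin p
  A b = (b +ᶠ -ᶠ κ) *ᶠ (b +ᶠ -ᶠ ν)
  B b = ι (+ 2) *ᶠ K *ᶠ b *ᶠ (κ +ᶠ -ᶠ b)
  G b = κ *ᶠ ν *ᶠ (b *ᶠ b)
  z b = b *ᶠ ((b +ᶠ -ᶠ κ) *ᶠ (b +ᶠ μ))

  disc-quadratic : ∀ b c → disc b c ≡ quadratic (A b) (B b) (G b) c
  disc-quadratic b c = solve 3 (λ K b c →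
    let κ = K :- con (+ 2)
        ν = K :+ con (+ 2)
        t = K :* (b :+ c) :- b :* c
    in t :* t :- con (+ 4) :* (con 1ℤ :* (b :* b :+ c :* c :+ K :* (b :* c))) :=
       (b :- κ) :* (b :- ν) :* (c :* c) :+ con (+ 2) :* K :* b :* (κ :- b) :* c :+ κ :* ν :* (b :* b)) refl K b c

  Δ : Fin p → Fin p
  Δ b = discriminant (A b) (B b) (G b)

  Δ-factor : ∀ b → Δ b ≡ ι (+ 16) *ᶠ b *ᶠ z b
  Δ-factor b = solve 2 (λ K b →
    let κ = K :- con (+ 2)
        ν = K :+ con (+ 2)
        B = con (+ 2) :* K :* b :* (κ :- b)
    in B :* B :- con (+ 4) :* ((b :- κ) :* (b :- ν) :* (κ :* ν :* (b :* b))) :=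
       con (+ 16) :* b :* (b :* ((b :- κ) :* (b :+ κ :* (K :+ con 1ℤ))))) refl K b

  Δ-factor′ : ∀ b → Δ b ≡ (ι (+ 4) *ᶠ b) *ᶠ (ι (+ 4) *ᶠ b) *ᶠ ((b +ᶠ -ᶠ κ) *ᶠ (b +ᶠ μ))
  Δ-factor′ b = trans (Δ-factor b) (solve 3 (λ b u v →
    con (+ 16) :* b :* (b :* (u :* v)) := con (+ 4) :* b :* (con (+ 4) :* b) :* (u :* v)) refl b (b +ᶠ -ᶠ κ) (b +ᶠ μ))

  A-cases : ∀ {b} → A b ≡ 0ᶠ → b ≡ κ ⊎ b ≡ ν
  A-cases {b} A≡0 with x*y≡0⇒x≡0∨y≡0 (b +ᶠ -ᶠ κ) (b +ᶠ -ᶠ ν) A≡0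
  ... | inj₁ b≡κ = inj₁ (-‿≡0⇒≡ b≡κ)
  ... | inj₂ b≡λ = inj₂ (-‿≡0⇒≡ b≡λ)

  z-cases : ∀ {b} → z b ≡ 0ᶠ → b ≡ 0ᶠ ⊎ b ≡ κ ⊎ b ≡ -ᶠ μ
  z-cases {b} z≡0 with x*y≡0⇒x≡0∨y≡0 b _ z≡0
  ... | inj₁ b≡0 = inj₁ b≡0
  ... | inj₂ uv≡0 with x*y≡0⇒x≡0∨y≡0 (b +ᶠ -ᶠ κ) (b +ᶠ μ) uv≡0
  ...   | inj₁ b≡κ  = inj₂ (inj₁ (-‿≡0⇒≡ b≡κ))
  ...   | inj₂ b≡-μ = inj₂ (inj₂ (-‿≡0⇒≡ (trans (solve 2 (λ b μ → b :- :- μ := b :+ μ) refl b μ) b≡-μ)))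

  z-ν : z ν ≡ ν *ᶠ (ι (+ 4) *ᶠ (K *ᶠ K))
  z-ν = solve 1 (λ K →
    let κ = K :- con (+ 2)
        ν = K :+ con (+ 2)
    in ν :* ((ν :- κ) :* (ν :+ κ :* (K :+ con 1ℤ))) := ν :* (con (+ 4) :* (K :* K))) refl K

  z-κ : z κ ≡ 0ᶠ
  z-κ = solve 3 (λ K κ μ → κ :* ((κ :- κ) :* (κ :+ μ)) := con 0ℤ) refl K κ μ

  A-κ : A κ ≡ 0ᶠ
  A-κ = solve 2 (λ κ l → (κ :- κ) :* (κ :- l) := con 0ℤ) refl κ ν

  B-κ : B κ ≡ 0ᶠ
  B-κ = solve 2 (λ K κ → con (+ 2) :* K :* κ :* (κ :- κ) := con 0ℤ) refl K κ

  B-ν : B ν ≡ -ᶠ ι (+ 8) *ᶠ (K *ᶠ ν)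
  B-ν = solve 1 (λ K →
    let κ = K :- con (+ 2)
        ν = K :+ con (+ 2)
    in con (+ 2) :* K :* ν :* (κ :- ν) := :- con (+ 8) :* (K :* ν)) refl K

  A-0 : A 0ᶠ ≡ κ *ᶠ ν
  A-0 = solve 2 (λ κ l → (con 0ℤ :- κ) :* (con 0ℤ :- l) := κ :* l) refl κ ν

  A-μ : A (-ᶠ μ) ≡ K *ᶠ K *ᶠ (κ *ᶠ ν)
  A-μ = solve 1 (λ K →
    let κ = K :- con (+ 2)
        ν = K :+ con (+ 2)
        μ = κ :* (K :+ con 1ℤ)
    in (:- μ :- κ) :* (:- μ :- ν) := K :* K :* (κ :* ν)) refl K

  σ-G : ∀ {b} → b ≢ 0ᶠ → σ (G b) ≡ σ (κ *ᶠ ν)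
  σ-G {b} b≢0 = trans (cong σ (solve 2 (λ u b → u :* (b :* b) := b :* b :* u) refl (κ *ᶠ ν) b)) (σ-square-* b (κ *ᶠ ν) b≢0)

  -8≢0 : -ᶠ ι (+ 8) ≢ 0ᶠ
  -8≢0 -8≡0 = *-≢0 2≢0 4≢0 (multiple≡0 (-ᶠ 1ᶠ) (solve 0 (con (+ 2) :* con (+ 4) := :- con 1ℤ :* (:- con (+ 8))) refl) -8≡0)

  s₊ : ℤ
  s₊ = σ (κ *ᶠ ν)

  -- For `A b ≠ 0` the row sum is `σ (A b) (p [Δ b = 0] - 1)`. At the zeros of `z` among these rows,
  -- `A b` is `κ ν` or `K² κ ν`, so the sign in front of `p` is `s₊` both times. The degenerate rows
  -- fit the same formula. `disc κ` is constant in the square class of `κ ν`, and `z κ = 0`.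
  -- `disc ν` is linear with sum 0 if `K ≠ 0` and a constant in that class if `K = 0`; since
  -- `z ν = 4 K² ν`, the term in `p` appears exactly in the second case.
  sum-σ-disc : ∀ b → sum (λ c → σ (disc b c)) ≡ + p * σ (κ *ᶠ ν) * δ (z b) - σ (A b)
  sum-σ-disc b = trans (sum-cong-≗ λ c → cong σ (disc-quadratic b c)) (go (A b ≟ᶠ 0ᶠ))
    where
    open ≡-Reasoning
    s = s₊
    eq₀ : ∀ n s t → n * s * 0ℤ - t ≡ t * (n * 0ℤ - 1ℤ)
    eq₀ = solve-∀
    eq₁ : ∀ n s → n * s * 1ℤ - s ≡ s * (n * 1ℤ - 1ℤ)
    eq₁ = solve-∀
    eq₂ : ∀ n s → n * s * 1ℤ - 0ℤ ≡ n * s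
    eq₂ = solve-∀
    degenerate : z b ≡ 0ᶠ → A b ≡ 0ᶠ → + p * s * δ (z b) - σ (A b) ≡ + p * s
    degenerate z≡0 A≡0 = trans (cong₂ (λ d a → + p * s * d - a) (δ-≡0 z≡0) (σ-zero A≡0)) (eq₂ (+ p) s)
    go : Dec (A b ≡ 0ᶠ) → sum (λ c → σ (quadratic (A b) (B b) (G b) c)) ≡ + p * s * δ (z b) - σ (A b)
    go (no A≢0) = trans (sum-σ-quadratic (B b) (G b) A≢0) (sym (generic (z b ≟ᶠ 0ᶠ)))
      where
      σA : z b ≡ 0ᶠ → σ (A b) ≡ s
      σA z≡0 with z-cases z≡0
      ... | inj₁ refl        = cong σ A-0
      ... | inj₂ (inj₁ refl) = ⊥-elim (A≢0 A-κ)
      ... | inj₂ (inj₂ refl) = trans (cong σ A-μ) (σ-square-* K (κ *ᶠ ν) K≢0)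
        where
        K≢0 : K ≢ 0ᶠ
        K≢0 K≡0 = A≢0 (trans A-μ (multiple≡0 (K *ᶠ (κ *ᶠ ν)) (solve 2 (λ K u → K :* K :* u := K :* u :* K) refl K (κ *ᶠ ν)) K≡0))
      generic : Dec (z b ≡ 0ᶠ) → + p * s * δ (z b) - σ (A b) ≡ σ (A b) * (+ p * δ (Δ b) - 1ℤ)
      generic (yes z≡0) = begin
        + p * s * δ (z b) - σ (A b)       ≡⟨ cong₂ (λ d a → + p * s * d - a) (δ-≡0 z≡0) (σA z≡0) ⟩
        + p * s * 1ℤ - s                  ≡⟨ eq₁ (+ p) s ⟩
        s * (+ p * 1ℤ - 1ℤ)               ≡⟨ cong₂ (λ a d → a * (+ p * d - 1ℤ)) (σA z≡0) (δ-≡0 (multiple≡0 _ (Δ-factor b) z≡0)) ⟨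
        σ (A b) * (+ p * δ (Δ b) - 1ℤ)    ∎
      generic (no z≢0) = begin
        + p * s * δ (z b) - σ (A b)       ≡⟨ cong (λ d → + p * s * d - σ (A b)) (δ-≢0 z≢0) ⟩
        + p * s * 0ℤ - σ (A b)            ≡⟨ eq₀ (+ p) s (σ (A b)) ⟩
        σ (A b) * (+ p * 0ℤ - 1ℤ)         ≡⟨ cong (λ d → σ (A b) * (+ p * d - 1ℤ)) (δ-≢0 Δ≢0) ⟨
        σ (A b) * (+ p * δ (Δ b) - 1ℤ)    ∎
        where
        b≢0 : b ≢ 0ᶠ
        b≢0 b≡0 = z≢0 (multiple≡0 ((b +ᶠ -ᶠ κ) *ᶠ (b +ᶠ μ)) (solve 2 (λ b u → b :* u := u :* b) refl b _) b≡0)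
        Δ≢0 : Δ b ≢ 0ᶠ
        Δ≢0 = *-≢0 (*-≢0 16≢0 b≢0) z≢0 ∘ trans (sym (Δ-factor b))
    go (yes A≡0) with A-cases A≡0
    ... | inj₁ refl = begin
      sum (λ c → σ (quadratic (A b) (B b) (G b) c))    ≡⟨ sum-constant (G b) A≡0 B-κ σ ⟩
      + p * σ (G b)                                    ≡⟨ cong (+ p *_) (σ-G κ≢0) ⟩
      + p * s                                          ≡⟨ degenerate z-κ A≡0 ⟨
      + p * s * δ (z b) - σ (A b)                      ∎
    ... | inj₂ refl with K ≟ᶠ 0ᶠ
    ...   | yes K≡0 = begin
      sum (λ c → σ (quadratic (A b) (B b) (G b) c))    ≡⟨ sum-constant (G b) A≡0 (multiple≡0 (-ᶠ ι (+ 8) *ᶠ ν) (trans B-ν (solve 3 (λ u v w → u :* (v :* w) := u :* w :* v) refl _ K ν)) K≡0) σ ⟩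
      + p * σ (G b)                                    ≡⟨ cong (+ p *_) (σ-G ν≢0) ⟩
      + p * s                                          ≡⟨ degenerate (multiple≡0 (ν *ᶠ (ι (+ 4) *ᶠ K)) (trans z-ν (solve 3 (λ u v w → u :* (v :* (w :* w)) := u :* (v :* w) :* w) refl ν _ K)) K≡0) A≡0 ⟨
      + p * s * δ (z b) - σ (A b)                      ∎
    ...   | no K≢0 = begin
      sum (λ c → σ (quadratic (A b) (B b) (G b) c))    ≡⟨ sum-linear (G b) A≡0 (*-≢0 -8≢0 (*-≢0 K≢0 ν≢0) ∘ trans (sym B-ν)) σ ⟩
      sum σ                                            ≡⟨ sum-σ ⟩
      0ℤ                                               ≡⟨ eq₃ (+ p * s) ⟩
      + p * s * 0ℤ - 0ℤ                                ≡⟨ cong₂ (λ d a → + p * s * d - a) (δ-≢0 (*-≢0 ν≢0 (*-≢0 4≢0 (*-≢0 K≢0 K≢0)) ∘ trans (sym z-ν))) (σ-zero A≡0) ⟨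
      + p * s * δ (z b) - σ (A b)                      ∎
      where
      eq₃ : ∀ t → 0ℤ ≡ t * 0ℤ - 0ℤ
      eq₃ = solve-∀

  -- The number of values of b for which disc b has a double root or is constant in c.
  n₀ : ℤ
  n₀ = + 3 - δ (K +ᶠ 1ᶠ)

  -- Among the roots `0`, `κ` and `-μ` of `z`, the root `κ` differs from the others because `κ ≠ 0`
  -- and `κ + μ = κ ν ≠ 0`. The roots `0` and `-μ` agree exactly when `K = -1`; the term `δ b * d`
  -- removes that double count.
  sum-δ-z : sum (λ b → δ (z b)) ≡ n₀
  sum-δ-z = begin
    sum (λ b → δ (z b))                                     ≡⟨ sum-cong-≗ split ⟩
    sum (λ b → (δ b + f b + g b) - δ b * d)                 ≡⟨ ∑-distrib-minus (λ b → δ b + f b + g b) (λ b → δ b * d) ⟩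
    sum (λ b → δ b + f b + g b) - sum (λ b → δ b * d)       ≡⟨ cong₂ _-_ (trans (∑-distrib-+ (λ b → δ b + f b) g) (cong (_+ sum g) (∑-distrib-+ δ f)))
                                                                       (trans (sum-cong-≗ λ b → ℤ.*-comm (δ b) d) (sym (*-distribˡ-sum d δ))) ⟩
    sum δ + sum f + sum g - d * sum δ                       ≡⟨ cong₂ _-_ (cong₂ _+_ (cong₂ _+_ sum-δ (sum-δ- κ)) (trans (sum-shift μ δ) sum-δ)) (trans (cong (d *_) sum-δ) (ℤ.*-identityʳ d)) ⟩
    + 3 - d                                                 ∎
    where
    open ≡-Reasoning
    d = δ (K +ᶠ 1ᶠ)
    f g : Fin p → ℤ
    f b = δ (b +ᶠ -ᶠ κ)
    g b = δ (b +ᶠ μ)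
    -μ≢κ : ∀ {b} → b +ᶠ -ᶠ κ ≡ 0ᶠ → b +ᶠ μ ≢ 0ᶠ
    -μ≢κ {b} b≡κ b≡-μ = *-≢0 κ≢0 ν≢0 (begin
      κ *ᶠ ν                       ≡⟨ solve 2 (λ K b → let κ = K :- con (+ 2) in κ :* (K :+ con (+ 2)) := (b :+ κ :* (K :+ con 1ℤ)) :- (b :- κ)) refl K b ⟩
      b +ᶠ μ +ᶠ -ᶠ (b +ᶠ -ᶠ κ)      ≡⟨ ≡⇒-‿≡0 (trans b≡-μ (sym b≡κ)) ⟩
      0ᶠ                            ∎)
    split : ∀ b → δ (z b) ≡ (δ b + f b + g b) - δ b * d
    split b with b ≟ᶠ 0ᶠ
    ... | yes refl = begin
      δ (z 0ᶠ)                                   ≡⟨ δ-≡0 (solve 1 (λ u → con 0ℤ :* u := con 0ℤ) refl _) ⟩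
      1ℤ                                         ≡⟨ eq d ⟩
      1ℤ + 0ℤ + d - 1ℤ * d                       ≡⟨ cong₂ (λ x y → 1ℤ + x + y - 1ℤ * d)
                                                      (δ-≢0 (κ≢0 ∘ sym ∘ -‿≡0⇒≡))
                                                      (δ-cong {0ᶠ +ᶠ μ} {K +ᶠ 1ᶠ} (*-cancel-0 κ≢0 ∘ trans (solve 1 (λ μ → μ := con 0ℤ :+ μ) refl μ))
                                                                (λ e → trans (solve 1 (λ μ → con 0ℤ :+ μ := μ) refl μ) (multiple≡0 κ refl e))) ⟨
      1ℤ + f 0ᶠ + g 0ᶠ - 1ℤ * d                  ∎
      where
      eq : ∀ d → 1ℤ ≡ 1ℤ + 0ℤ + d - 1ℤ * d
      eq = solve-∀
    ... | no b≢0 with b +ᶠ -ᶠ κ ≟ᶠ 0ᶠ | b +ᶠ μ ≟ᶠ 0ᶠ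
    ...   | yes b≡κ | yes b≡-μ = ⊥-elim (-μ≢κ b≡κ b≡-μ)
    ...   | yes b≡κ | no _     = δ-≡0 (multiple≡0 (b *ᶠ (b +ᶠ μ)) (solve 3 (λ x y z → x :* (y :* z) := x :* z :* y) refl b _ _) b≡κ)
    ...   | no _    | yes b≡-μ = δ-≡0 (multiple≡0 (b *ᶠ (b +ᶠ -ᶠ κ)) (solve 3 (λ x y z → x :* (y :* z) := x :* y :* z) refl b _ _) b≡-μ)
    ...   | no b≢κ  | no b≢-μ  = δ-≢0 (*-≢0 b≢0 (*-≢0 b≢κ b≢-μ))

  -- The roots `κ` and `ν` differ by 4, so the discriminant is 16 whatever `K` is.
  sum-σ-A : sum (λ b → σ (A b)) ≡ -1ℤ
  sum-σ-A = begin
    sum (λ b → σ (A b))                                      ≡⟨ sum-cong-≗ (λ b → cong σ (solve 3 (λ b κ l → (b :- κ) :* (b :- l) := con 1ℤ :* (b :* b) :+ (:- (κ :+ l)) :* b :+ κ :* l) refl b κ ν)) ⟩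
    sum (λ b → σ (quadratic 1ᶠ (-ᶠ (κ +ᶠ ν)) (κ *ᶠ ν) b))  ≡⟨ sum-σ-quadratic (-ᶠ (κ +ᶠ ν)) (κ *ᶠ ν) 1≢0 ⟩
    σ 1ᶠ * (+ p * δ D - 1ℤ)                                  ≡⟨ cong₂ (λ s d → s * (+ p * d - 1ℤ)) (σ-square 1ᶠ 1≢0 (solve 0 (con 1ℤ := con 1ℤ :* con 1ℤ) refl)) (δ-≢0 D≢0) ⟩
    1ℤ * (+ p * 0ℤ - 1ℤ)                                     ≡⟨ eq (+ p) ⟩
    -1ℤ                                                      ∎
    where
    open ≡-Reasoning
    D = discriminant 1ᶠ (-ᶠ (κ +ᶠ ν)) (κ *ᶠ ν)
    D≢0 : D ≢ 0ᶠ
    D≢0 = 16≢0 ∘ trans (sym (solve 1 (λ K →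
      let κ = K :- con (+ 2)
          ν = K :+ con (+ 2)
      in (:- (κ :+ ν)) :* (:- (κ :+ ν)) :- con (+ 4) :* (con 1ℤ :* (κ :* ν)) := con (+ 16)) refl K))
    eq : ∀ n → 1ℤ * (n * 0ℤ - 1ℤ) ≡ -1ℤ
    eq = solve-∀

  -- Triple sums and the number of points of the surface.

  sum₃ : (Fin p → Fin p → Fin p → ℤ) → ℤ
  sum₃ f = sum λ a → sum λ b → sum λ c → f a b c

  sum₃-cong : ∀ {f g} → (∀ a b c → f a b c ≡ g a b c) → sum₃ f ≡ sum₃ g
  sum₃-cong f≗g = sum-cong-≗ λ a → sum-cong-≗ λ b → sum-cong-≗ (f≗g a b)

  sum₃-distrib-+ : ∀ f g → sum₃ (λ a b c → f a b c + g a b c) ≡ sum₃ f + sum₃ g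
  sum₃-distrib-+ f g = trans
    (sum-cong-≗ λ a → trans (sum-cong-≗ λ b → ∑-distrib-+ (f a b) (g a b)) (∑-distrib-+ (λ b → sum (f a b)) (λ b → sum (g a b))))
    (∑-distrib-+ (λ a → sum λ b → sum (f a b)) (λ a → sum λ b → sum (g a b)))

  sum₃-distribˡ-* : ∀ k f → sum₃ (λ a b c → k * f a b c) ≡ k * sum₃ f
  sum₃-distribˡ-* k f = sym (trans (*-distribˡ-sum k (λ a → sum λ b → sum (f a b)))
    (sum-cong-≗ λ a → trans (*-distribˡ-sum k (λ b → sum (f a b))) (sum-cong-≗ λ b → *-distribˡ-sum k (f a b))))

  sum₃-swap : ∀ f → sum₃ f ≡ sum₃ (λ a b c → f b a c)
  sum₃-swap f = ∑-comm (λ a b → sum (f a b))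

  sum₃-rotate : ∀ f → sum₃ f ≡ sum₃ (λ b c a → f a b c)
  sum₃-rotate f = trans (sum₃-swap f) (sum-cong-≗ λ b → ∑-comm (λ a c → f a b c))

  -- Given b and c, there are 1 + σ (disc b c) values of a, and disc b c is in turn quadratic in c.
  points-total : sum₃ (λ a b c → δ (q a b c)) ≡ + p * + p + 1ℤ + + p * s₊ * n₀
  points-total = begin
    sum₃ (λ a b c → δ (q a b c))                          ≡⟨ sum₃-rotate (λ a b c → δ (q a b c)) ⟩
    sum₃ (λ b c a → δ (q a b c))                          ≡⟨ sum-cong-≗ (λ b → sum-cong-≗ λ c → sum-δ-quadratic (tr b c) (nm b c) 1≢0) ⟩
    sum (λ b → sum (λ c → 1ℤ + σ (disc b c)))             ≡⟨ sum-cong-≗ inner ⟩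
    sum (λ b → (+ p + t * δ (z b)) - σ (A b))             ≡⟨ ∑-distrib-minus (λ b → + p + t * δ (z b)) (λ b → σ (A b)) ⟩
    sum (λ b → + p + t * δ (z b)) - sum (λ b → σ (A b))   ≡⟨ cong₂ _-_ (∑-distrib-+ (λ _ → + p) (λ b → t * δ (z b))) sum-σ-A ⟩
    sum {p} (λ _ → + p) + sum (λ b → t * δ (z b)) - -1ℤ   ≡⟨ cong₂ (λ x y → x + y - -1ℤ) (sum-const p (+ p)) (trans (sym (*-distribˡ-sum t (λ b → δ (z b)))) (cong (t *_) sum-δ-z)) ⟩
    + p * + p + t * n₀ - -1ℤ             ≡⟨ eq (+ p * + p) (t * n₀) ⟩
    + p * + p + 1ℤ + t * n₀              ∎
    where
    open ≡-Reasoning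
    t = + p * s₊
    eq : ∀ x y → x + y - -1ℤ ≡ x + 1ℤ + y
    eq = solve-∀
    eq′ : ∀ n x y → n * 1ℤ + (x - y) ≡ n + x - y
    eq′ = solve-∀
    inner : ∀ b → sum (λ c → 1ℤ + σ (disc b c)) ≡ (+ p + t * δ (z b)) - σ (A b)
    inner b = begin
      sum (λ c → 1ℤ + σ (disc b c))                       ≡⟨ ∑-distrib-+ (λ _ → 1ℤ) (λ c → σ (disc b c)) ⟩
      sum {p} (λ _ → 1ℤ) + sum (λ c → σ (disc b c))       ≡⟨ cong₂ _+_ (sum-const p 1ℤ) (sum-σ-disc b) ⟩
      + p * 1ℤ + (t * δ (z b) - σ (A b))                  ≡⟨ eq′ (+ p) (t * δ (z b)) (σ (A b)) ⟩
      + p + t * δ (z b) - σ (A b)                         ∎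

  -- Points fixed by one given flip.

  w : Fin p → Fin p
  w b = (b +ᶠ -ᶠ κ) *ᶠ (b +ᶠ μ)

  s₋ : ℤ
  s₋ = σ (-ᶠ K +ᶠ -ᶠ 1ᶠ)

  ν≢κ : ν +ᶠ -ᶠ κ ≢ 0ᶠ
  ν≢κ = 4≢0 ∘ trans (solve 1 (λ K → con (+ 4) := K :+ con (+ 2) :- (K :- con (+ 2))) refl K)

  κ≢ν : κ +ᶠ -ᶠ ν ≢ 0ᶠ
  κ≢ν κ≡ν = ν≢κ (≡⇒-‿≡0 (sym (-‿≡0⇒≡ κ≡ν)))

  w-ν : w ν ≡ (ι (+ 2) *ᶠ K) *ᶠ (ι (+ 2) *ᶠ K)
  w-ν = solve 1 (λ K →
    let κ = K :- con (+ 2)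
        ν = K :+ con (+ 2)
    in (ν :- κ) :* (ν :+ κ :* (K :+ con 1ℤ)) := con (+ 2) :* K :* (con (+ 2) :* K)) refl K

  -- `Δ b` is `(4b)²` times `w b`, so the count is `1 + σ (w b)` outside three rows. At `b = 0` the
  -- discriminant vanishes although `w 0 = κ² (-K - 1)`, and the sign `s₋` of the latter is taken
  -- back. At `b = κ` the row is a nonzero constant and `w κ = 0`, so the 1 is taken back. At
  -- `b = ν`, where `w ν = (2K)²`, subtracting 1 leaves 1 for `K ≠ 0`, when the row is linear, and 0
  -- for `K = 0`, when it is a nonzero constant.
  sum-δ-disc : ∀ b → sum (λ c → δ (disc b c)) ≡
    1ℤ + σ (w b) - δ b * s₋ - δ (b +ᶠ -ᶠ κ) - δ (b +ᶠ -ᶠ ν)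
  sum-δ-disc b = trans (sum-cong-≗ λ c → cong δ (disc-quadratic b c)) (go (A b ≟ᶠ 0ᶠ))
    where
    open ≡-Reasoning
    rhs : (σw δb δκ δν : ℤ) → ℤ
    rhs σw δb δκ δν = 1ℤ + σw - δb * s₋ - δκ - δν
    rhs-cong : ∀ {x x′ y y′ u u′ v v′} → x ≡ x′ → y ≡ y′ → u ≡ u′ → v ≡ v′ → rhs x y u v ≡ rhs x′ y′ u′ v′
    rhs-cong refl refl refl refl = refl
    go : Dec (A b ≡ 0ᶠ) → sum (λ c → δ (quadratic (A b) (B b) (G b) c)) ≡
      1ℤ + σ (w b) - δ b * s₋ - δ (b +ᶠ -ᶠ κ) - δ (b +ᶠ -ᶠ ν)
    go (no A≢0) = trans (sum-δ-quadratic (B b) (G b) A≢0) (generic (b ≟ᶠ 0ᶠ))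
      where
      b≢κ : b +ᶠ -ᶠ κ ≢ 0ᶠ
      b≢κ e = A≢0 (multiple≡0 (b +ᶠ -ᶠ ν) (solve 2 (λ x y → x :* y := y :* x) refl _ _) e)
      b≢ν : b +ᶠ -ᶠ ν ≢ 0ᶠ
      b≢ν e = A≢0 (multiple≡0 (b +ᶠ -ᶠ κ) refl e)
      generic : Dec (b ≡ 0ᶠ) → 1ℤ + σ (Δ b) ≡ rhs (σ (w b)) (δ b) (δ (b +ᶠ -ᶠ κ)) (δ (b +ᶠ -ᶠ ν))
      generic (yes b≡0@refl) = begin
        1ℤ + σ (Δ b)            ≡⟨ cong (λ t → 1ℤ + t) (σ-zero (trans (Δ-factor b) (solve 1 (λ u → con (+ 16) :* con 0ℤ :* u := con 0ℤ) refl (z b)))) ⟩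
        1ℤ                      ≡⟨ eq s₋ ⟩
        rhs s₋ 1ℤ 0ℤ 0ℤ         ≡⟨ rhs-cong σw (δ-≡0 b≡0) (δ-≢0 b≢κ) (δ-≢0 b≢ν) ⟨
        rhs (σ (w b)) (δ b) (δ (b +ᶠ -ᶠ κ)) (δ (b +ᶠ -ᶠ ν))  ∎
        where
        eq : ∀ s → 1ℤ ≡ 1ℤ + s - 1ℤ * s - 0ℤ - 0ℤ
        eq = solve-∀
        σw : σ (w 0ᶠ) ≡ s₋
        σw = trans (cong σ (solve 2 (λ κ K → (con 0ℤ :- κ) :* (con 0ℤ :+ κ :* (K :+ con 1ℤ)) := κ :* κ :* (:- K :- con 1ℤ)) refl κ K))
                   (σ-square-* κ _ κ≢0)
      generic (no b≢0) = begin
        1ℤ + σ (Δ b)                ≡⟨ cong (λ t → 1ℤ + t) (trans (cong σ (Δ-factor′ b)) (σ-square-* (ι (+ 4) *ᶠ b) (w b) (*-≢0 4≢0 b≢0))) ⟩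
        1ℤ + σ (w b)                ≡⟨ eq s₋ (σ (w b)) ⟩
        rhs (σ (w b)) 0ℤ 0ℤ 0ℤ      ≡⟨ rhs-cong (refl {x = σ (w b)}) (δ-≢0 b≢0) (δ-≢0 b≢κ) (δ-≢0 b≢ν) ⟨
        rhs (σ (w b)) (δ b) (δ (b +ᶠ -ᶠ κ)) (δ (b +ᶠ -ᶠ ν))  ∎
        where
        eq : ∀ s t → 1ℤ + t ≡ 1ℤ + t - 0ℤ * s - 0ℤ - 0ℤ
        eq = solve-∀
    go (yes A≡0) with A-cases A≡0
    ... | inj₁ refl = begin
      sum (λ c → δ (quadratic (A b) (B b) (G b) c))    ≡⟨ sum-constant (G b) A≡0 B-κ δ ⟩
      + p * δ (G b)                                    ≡⟨ cong (+ p *_) (δ-≢0 (*-≢0 (*-≢0 κ≢0 ν≢0) (*-≢0 κ≢0 κ≢0))) ⟩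
      + p * 0ℤ                                         ≡⟨ eq (+ p) s₋ ⟩
      rhs 0ℤ 0ℤ 1ℤ 0ℤ                                  ≡⟨ rhs-cong (σ-zero (solve 2 (λ κ μ → (κ :- κ) :* (κ :+ μ) := con 0ℤ) refl κ μ))
                                                            (δ-≢0 κ≢0) (δ-≡0 (≡⇒-‿≡0 refl)) (δ-≢0 κ≢ν) ⟨
      rhs (σ (w b)) (δ b) (δ (b +ᶠ -ᶠ κ)) (δ (b +ᶠ -ᶠ ν))  ∎
      where
      eq : ∀ n s → n * 0ℤ ≡ 1ℤ + 0ℤ - 0ℤ * s - 1ℤ - 0ℤ
      eq = solve-∀
    ... | inj₂ refl with K ≟ᶠ 0ᶠ
    ...   | yes K≡0 = begin
      sum (λ c → δ (quadratic (A b) (B b) (G b) c))    ≡⟨ sum-constant (G b) A≡0 (multiple≡0 (-ᶠ ι (+ 8) *ᶠ ν) (trans B-ν (solve 3 (λ u v w → u :* (v :* w) := u :* w :* v) refl _ K ν)) K≡0) δ ⟩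
      + p * δ (G b)                                    ≡⟨ cong (+ p *_) (δ-≢0 (*-≢0 (*-≢0 κ≢0 ν≢0) (*-≢0 ν≢0 ν≢0))) ⟩
      + p * 0ℤ                                         ≡⟨ eq (+ p) s₋ ⟩
      rhs 0ℤ 0ℤ 0ℤ 1ℤ                                  ≡⟨ rhs-cong (σ-zero (trans w-ν (multiple≡0 (ι (+ 4) *ᶠ K) (solve 1 (λ K → con (+ 2) :* K :* (con (+ 2) :* K) := con (+ 4) :* K :* K) refl K) K≡0)))
                                                            (δ-≢0 ν≢0) (δ-≢0 ν≢κ) (δ-≡0 (≡⇒-‿≡0 refl)) ⟨
      rhs (σ (w b)) (δ b) (δ (b +ᶠ -ᶠ κ)) (δ (b +ᶠ -ᶠ ν))  ∎
      where
      eq : ∀ n s → n * 0ℤ ≡ 1ℤ + 0ℤ - 0ℤ * s - 0ℤ - 1ℤ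
      eq = solve-∀
    ...   | no K≢0 = begin
      sum (λ c → δ (quadratic (A b) (B b) (G b) c))    ≡⟨ sum-linear (G b) A≡0 (*-≢0 -8≢0 (*-≢0 K≢0 ν≢0) ∘ trans (sym B-ν)) δ ⟩
      sum δ                                            ≡⟨ sum-δ ⟩
      1ℤ                                               ≡⟨ eq s₋ ⟩
      rhs 1ℤ 0ℤ 0ℤ 1ℤ                                  ≡⟨ rhs-cong (σ-square (ι (+ 2) *ᶠ K) (*-≢0 2≢0 K≢0) w-ν)
                                                            (δ-≢0 ν≢0) (δ-≢0 ν≢κ) (δ-≡0 (≡⇒-‿≡0 refl)) ⟨
      rhs (σ (w b)) (δ b) (δ (b +ᶠ -ᶠ κ)) (δ (b +ᶠ -ᶠ ν))  ∎
      where
      eq : ∀ s → 1ℤ ≡ 1ℤ + 1ℤ - 0ℤ * s - 0ℤ - 1ℤ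
      eq = solve-∀

  -- The roots `κ` and `-μ` differ by `κ + μ = κ ν`, so the discriminant is `(κ ν)²`.
  sum-σ-w : sum (λ b → σ (w b)) ≡ -1ℤ
  sum-σ-w = begin
    sum (λ b → σ (w b))                                      ≡⟨ sum-cong-≗ (λ b → cong σ (solve 3 (λ b κ μ → (b :- κ) :* (b :+ μ) := con 1ℤ :* (b :* b) :+ (μ :- κ) :* b :+ (:- (κ :* μ))) refl b κ μ)) ⟩
    sum (λ b → σ (quadratic 1ᶠ (μ +ᶠ -ᶠ κ) (-ᶠ (κ *ᶠ μ)) b)) ≡⟨ sum-σ-quadratic (μ +ᶠ -ᶠ κ) (-ᶠ (κ *ᶠ μ)) 1≢0 ⟩
    σ 1ᶠ * (+ p * δ D - 1ℤ)                                  ≡⟨ cong₂ (λ s d → s * (+ p * d - 1ℤ)) (σ-square 1ᶠ 1≢0 (solve 0 (con 1ℤ := con 1ℤ :* con 1ℤ) refl)) (δ-≢0 D≢0) ⟩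
    1ℤ * (+ p * 0ℤ - 1ℤ)                                     ≡⟨ eq (+ p) ⟩
    -1ℤ                                                      ∎
    where
    open ≡-Reasoning
    D = discriminant 1ᶠ (μ +ᶠ -ᶠ κ) (-ᶠ (κ *ᶠ μ))
    D≢0 : D ≢ 0ᶠ
    D≢0 = *-≢0 (*-≢0 κ≢0 ν≢0) (*-≢0 κ≢0 ν≢0) ∘ trans (sym (solve 1 (λ K →
      let κ = K :- con (+ 2)
          ν = K :+ con (+ 2)
          μ = κ :* (K :+ con 1ℤ)
      in (μ :- κ) :* (μ :- κ) :- con (+ 4) :* (con 1ℤ :* (:- (κ :* μ))) := κ :* ν :* (κ :* ν)) refl K))
    eq : ∀ n → 1ℤ * (n * 0ℤ - 1ℤ) ≡ -1ℤ
    eq = solve-∀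

  -- `ℓ` is the derivative of `q` in `a`, whence `disc = ℓ² - 4 q`; where `ℓ` vanishes, `disc` and
  -- `q` differ by the unit `-4`.
  δq≡δdisc : ∀ a b c → ℓ a b c ≡ 0ᶠ → δ (q a b c) ≡ δ (disc b c)
  δq≡δdisc a b c ℓ≡0 = δ-cong {q a b c} {disc b c} to from
    where
    eq : disc b c ≡ ℓ a b c *ᶠ ℓ a b c +ᶠ -ᶠ (ι (+ 4) *ᶠ q a b c)
    eq = solve 3 (λ a t n → t :* t :- con (+ 4) :* (con 1ℤ :* n) :=
      (con (+ 2) :* a :+ t) :* (con (+ 2) :* a :+ t) :- con (+ 4) :* (con 1ℤ :* (a :* a) :+ t :* a :+ n)) refl a (tr b c) (nm b c)
    to : q a b c ≡ 0ᶠ → disc b c ≡ 0ᶠ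
    to q≡0 = trans eq (≡⇒-‿≡0 (trans (multiple≡0 (ℓ a b c) refl ℓ≡0) (sym (multiple≡0 (ι (+ 4)) refl q≡0))))
    from : disc b c ≡ 0ᶠ → q a b c ≡ 0ᶠ
    from disc≡0 = *-cancel-0 4≢0 (trans (sym (-‿≡0⇒≡ (trans (sym eq) disc≡0))) (multiple≡0 (ℓ a b c) refl ℓ≡0))

  -- Given `b` and `c`, the equation `ℓ = 0` has one solution `a` because 2 is invertible, and it
  -- lies on the surface iff `disc b c = 0`. What remains is to sum `sum-δ-disc` over `b`.
  fixed-by-one : sum₃ (λ a b c → δ (q a b c) * δ (ℓ a b c)) ≡ + p - + 3 - s₋
  fixed-by-one = begin
    sum₃ (λ a b c → δ (q a b c) * δ (ℓ a b c))            ≡⟨ sum₃-rotate (λ a b c → δ (q a b c) * δ (ℓ a b c)) ⟩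
    sum₃ (λ b c a → δ (q a b c) * δ (ℓ a b c))            ≡⟨ sum-cong-≗ (λ b → sum-cong-≗ λ c → inner b c) ⟩
    sum (λ b → sum (λ c → δ (disc b c)))                  ≡⟨ sum-cong-≗ sum-δ-disc ⟩
    sum (λ b → 1ℤ + σ (w b) - δ b * s₋ - f b - g b)       ≡⟨ ∑-distrib-minus (λ b → 1ℤ + σ (w b) - δ b * s₋ - f b) g ⟩
    sum (λ b → 1ℤ + σ (w b) - δ b * s₋ - f b) - sum g     ≡⟨ cong (_- sum g) (∑-distrib-minus (λ b → 1ℤ + σ (w b) - δ b * s₋) f) ⟩
    sum (λ b → 1ℤ + σ (w b) - δ b * s₋) - sum f - sum g   ≡⟨ cong (λ t → t - sum f - sum g) (∑-distrib-minus (λ b → 1ℤ + σ (w b)) (λ b → δ b * s₋)) ⟩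
    sum (λ b → 1ℤ + σ (w b)) - sum (λ b → δ b * s₋) - sum f - sum g
                                                          ≡⟨ cong (λ t → t - sum (λ b → δ b * s₋) - sum f - sum g) (∑-distrib-+ (λ _ → 1ℤ) (λ b → σ (w b))) ⟩
    sum {p} (λ _ → 1ℤ) + sum (λ b → σ (w b)) - sum (λ b → δ b * s₋) - sum f - sum g
                                                          ≡⟨ cong₂ (λ x y → x + y - sum (λ b → δ b * s₋) - sum f - sum g) (sum-const p 1ℤ) sum-σ-w ⟩
    + p * 1ℤ + -1ℤ - sum (λ b → δ b * s₋) - sum f - sum g ≡⟨ cong (λ t → + p * 1ℤ + -1ℤ - t - sum f - sum g)
                                                               (trans (sum-cong-≗ λ b → ℤ.*-comm (δ b) s₋) (trans (sym (*-distribˡ-sum s₋ δ)) (cong (s₋ *_) sum-δ))) ⟩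
    + p * 1ℤ + -1ℤ - s₋ * 1ℤ - sum f - sum g              ≡⟨ cong₂ (λ x y → + p * 1ℤ + -1ℤ - s₋ * 1ℤ - x - y) (sum-δ- κ) (sum-δ- ν) ⟩
    + p * 1ℤ + -1ℤ - s₋ * 1ℤ - 1ℤ - 1ℤ                    ≡⟨ eq (+ p) s₋ ⟩
    + p - + 3 - s₋                                        ∎
    where
    open ≡-Reasoning
    f g : Fin p → ℤ
    f b = δ (b +ᶠ -ᶠ κ)
    g b = δ (b +ᶠ -ᶠ ν)
    eq : ∀ n s → n * 1ℤ + -1ℤ - s * 1ℤ - 1ℤ - 1ℤ ≡ n - + 3 - s
    eq = solve-∀
    term : ∀ a b c → δ (q a b c) * δ (ℓ a b c) ≡ δ (disc b c) * δ (ℓ a b c)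
    term a b c with ℓ a b c ≟ᶠ 0ᶠ
    ... | yes ℓ≡0 = cong (_* 1ℤ) (δq≡δdisc a b c ℓ≡0)
    ... | no _    = trans (ℤ.*-zeroʳ (δ (q a b c))) (sym (ℤ.*-zeroʳ (δ (disc b c))))
    inner : ∀ b c → sum (λ a → δ (q a b c) * δ (ℓ a b c)) ≡ δ (disc b c)
    inner b c = begin
      sum (λ a → δ (q a b c) * δ (ℓ a b c))          ≡⟨ sum-cong-≗ (λ a → term a b c) ⟩
      sum (λ a → δ (disc b c) * δ (ℓ a b c))         ≡⟨ *-distribˡ-sum (δ (disc b c)) (λ a → δ (ℓ a b c)) ⟨
      δ (disc b c) * sum (λ a → δ (ℓ a b c))         ≡⟨ cong (δ (disc b c) *_) (sum-δ-linear (tr b c) 2≢0) ⟩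
      δ (disc b c) * 1ℤ                              ≡⟨ ℤ.*-identityʳ (δ (disc b c)) ⟩
      δ (disc b c)                                   ∎

  -- Points fixed by two or three flips.

  Origin Apex : (a b c : Fin p) → Set
  Origin a b c = a ≡ 0ᶠ × b ≡ 0ᶠ × c ≡ 0ᶠ
  -- For `K ≠ 0` this is the single point `(μ/K, μ/K, -μ)`. Avoiding the division keeps the
  -- conditions meaningful at `K = 0`, and having the form `t = 0` makes the indicator a product of
  -- values of `δ`.
  Apex a b c   = b +ᶠ -ᶠ a ≡ 0ᶠ × K *ᶠ a +ᶠ -ᶠ μ ≡ 0ᶠ × c +ᶠ K *ᶠ a ≡ 0ᶠ

  origin? : ∀ a b c → Dec (Origin a b c)
  origin? a b c = a ≟ᶠ 0ᶠ ×-dec b ≟ᶠ 0ᶠ ×-dec c ≟ᶠ 0ᶠ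

  apex? : ∀ a b c → Dec (Apex a b c)
  apex? a b c = b +ᶠ -ᶠ a ≟ᶠ 0ᶠ ×-dec K *ᶠ a +ᶠ -ᶠ μ ≟ᶠ 0ᶠ ×-dec c +ᶠ K *ᶠ a ≟ᶠ 0ᶠ

  FixedByTwo : (a b c : Fin p) → Set
  FixedByTwo a b c = q a b c ≡ 0ᶠ × ℓ a b c ≡ 0ᶠ × ℓ b a c ≡ 0ᶠ

  fixedByTwo? : ∀ a b c → Dec (FixedByTwo a b c)
  fixedByTwo? a b c = q a b c ≟ᶠ 0ᶠ ×-dec ℓ a b c ≟ᶠ 0ᶠ ×-dec ℓ b a c ≟ᶠ 0ᶠ

  -- On the branch `c = -K b` of the diagonal, the factor `b` leads to the origin and the other
  -- factor to the apex.
  ℓ-diagonal : ∀ b → ℓ b b (-ᶠ (K *ᶠ b)) ≡ b *ᶠ (K *ᶠ b +ᶠ -ᶠ μ)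
  ℓ-diagonal b = solve 2 (λ K b →
    let c = :- (K :* b)
        μ = (K :- con (+ 2)) :* (K :+ con 1ℤ)
    in con (+ 2) :* b :+ (K :* (b :+ c) :- b :* c) := b :* (K :* b :- μ)) refl K b

  -- At a fixed point the multiple of `ℓ` drops out, and the remaining product leaves only `c = 0`
  -- and `c = -K b`.
  q-diagonal : ∀ b c → q b b c ≡ b *ᶠ ℓ b b c +ᶠ c *ᶠ (c +ᶠ K *ᶠ b)
  q-diagonal b c = solve 3 (λ K b c →
    let t = K :* (b :+ c) :- b :* c
    in con 1ℤ :* (b :* b) :+ t :* b :+ (b :* b :+ c :* c :+ K :* (b :* c)) :=
       b :* (con (+ 2) :* b :+ t) :+ c :* (c :+ K :* b)) refl K b c

  +-≡0 : ∀ {x y} → x ≡ 0ᶠ → y ≡ 0ᶠ → x +ᶠ y ≡ 0ᶠ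
  +-≡0 refl refl = solve 0 (con 0ℤ :+ con 0ℤ := con 0ℤ) refl

  -- The difference of the two fixed-point equations is (a - b)(c - κ); the plane c = κ is
  -- excluded because there 4κ³ν is a combination of the equations.
  fixedByTwo⇒ : ∀ {a b c} → FixedByTwo a b c → Origin a b c ⊎ Apex a b c
  fixedByTwo⇒ {a} {b} {c} (q≡0 , ℓ≡0 , ℓ′≡0) with x*y≡0⇒x≡0∨y≡0 (a +ᶠ -ᶠ b) (c +ᶠ -ᶠ κ) product≡0
    where
    product≡0 : (a +ᶠ -ᶠ b) *ᶠ (c +ᶠ -ᶠ κ) ≡ 0ᶠ
    product≡0 = trans (solve 4 (λ K a b c →
      (a :- b) :* (c :- (K :- con (+ 2))) :=
      (con (+ 2) :* a :+ (K :* (b :+ c) :- b :* c)) :- (con (+ 2) :* b :+ (K :* (a :+ c) :- a :* c))) refl K a b c)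
      (≡⇒-‿≡0 (trans ℓ≡0 (sym ℓ′≡0)))
  ... | inj₂ c-κ≡0 with refl ← -‿≡0⇒≡ c-κ≡0 =
    ⊥-elim (*-≢0 4≢0 (*-≢0 (*-≢0 κ≢0 κ≢0) (*-≢0 κ≢0 ν≢0)) (trans certificate
      (≡⇒-‿≡0 (trans (multiple≡0 (ℓ a b κ +ᶠ ℓ b a κ) refl (+-≡0 ℓ≡0 ℓ′≡0)) (sym (multiple≡0 (ι (+ 16)) refl q≡0))))))
    where
    -- Put `s = a + b`. Because `K - κ = 2`, on the plane `c = κ` the polynomial `q` becomes
    -- `s² + K κ s + κ²`, and both `ℓ` become its derivative `2s + K κ`. The identity is four times
    -- "derivative squared minus 4 `q` equals discriminant", and the discriminant is
    -- `κ² (K² - 4) = κ³ ν`.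
    certificate : ι (+ 4) *ᶠ (κ *ᶠ κ *ᶠ (κ *ᶠ ν)) ≡
      (ℓ a b κ +ᶠ ℓ b a κ) *ᶠ (ℓ a b κ +ᶠ ℓ b a κ) +ᶠ -ᶠ (ι (+ 16) *ᶠ q a b κ)
    certificate = solve 3 (λ K a b →
      let κ = K :- con (+ 2)
          t = K :* (b :+ κ) :- b :* κ
          m = con (+ 2) :* a :+ t :+ (con (+ 2) :* b :+ (K :* (a :+ κ) :- a :* κ))
      in con (+ 4) :* (κ :* κ :* (κ :* (K :+ con (+ 2)))) :=
         m :* m :- con (+ 16) :* (con 1ℤ :* (a :* a) :+ t :* a :+ (b :* b :+ κ :* κ :+ K :* (b :* κ)))) refl K a b
  ... | inj₁ a-b≡0 with refl ← -‿≡0⇒≡ a-b≡0 with x*y≡0⇒x≡0∨y≡0 c (c +ᶠ K *ᶠ a) c*≡0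
    where
    c*≡0 : c *ᶠ (c +ᶠ K *ᶠ a) ≡ 0ᶠ
    c*≡0 = trans (solve 3 (λ u a l → u := a :* l :+ u :- a :* l) refl (c *ᶠ (c +ᶠ K *ᶠ a)) a (ℓ a a c))
      (≡⇒-‿≡0 (trans (sym (q-diagonal a c)) (trans q≡0 (sym (multiple≡0 a refl ℓ≡0)))))
  ...   | inj₁ refl = inj₁ (a≡0 , a≡0 , refl)
    where
    a≡0 : a ≡ 0ᶠ
    a≡0 = *-cancel-0 ν≢0 (trans (solve 2 (λ K a → (K :+ con (+ 2)) :* a :=
      con (+ 2) :* a :+ (K :* (a :+ con 0ℤ) :- a :* con 0ℤ)) refl K a) ℓ≡0)
  ...   | inj₂ c+Ka≡0 with refl ← -‿≡0⇒≡ (trans (solve 2 (λ c u → c :- (:- u) := c :+ u) refl c (K *ᶠ a)) c+Ka≡0)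
                      with x*y≡0⇒x≡0∨y≡0 a (K *ᶠ a +ᶠ -ᶠ μ) (trans (sym (ℓ-diagonal a)) ℓ≡0)
  ...     | inj₁ a≡0  = inj₁ (a≡0 , a≡0 , multiple≡0 (-ᶠ K) (solve 2 (λ K a → :- (K :* a) := :- K :* a) refl K a) a≡0)
  ...     | inj₂ Ka≡μ = inj₂ (a-b≡0 , Ka≡μ , c+Ka≡0)

  origin⇒fixedByTwo : ∀ {a b c} → Origin a b c → FixedByTwo a b c
  origin⇒fixedByTwo (refl , refl , refl) =
    solve 1 (λ K → con 1ℤ :* (con 0ℤ :* con 0ℤ) :+ (K :* (con 0ℤ :+ con 0ℤ) :- con 0ℤ :* con 0ℤ) :* con 0ℤ
                     :+ (con 0ℤ :* con 0ℤ :+ con 0ℤ :* con 0ℤ :+ K :* (con 0ℤ :* con 0ℤ)) := con 0ℤ) refl K ,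
    ℓ-0 , ℓ-0
    where
    ℓ-0 : ℓ 0ᶠ 0ᶠ 0ᶠ ≡ 0ᶠ
    ℓ-0 = solve 1 (λ K → con (+ 2) :* con 0ℤ :+ (K :* (con 0ℤ :+ con 0ℤ) :- con 0ℤ :* con 0ℤ) := con 0ℤ) refl K

  apex⇒fixedByTwo : ∀ {a b c} → Apex a b c → FixedByTwo a b c
  apex⇒fixedByTwo {a} {b} {c} (b≡a , Ka≡μ , c≡-Ka)
    with refl ← -‿≡0⇒≡ b≡a
    with refl ← -‿≡0⇒≡ (trans (solve 2 (λ c u → c :- (:- u) := c :+ u) refl c (K *ᶠ a)) c≡-Ka) =
    trans (q-diagonal a (-ᶠ (K *ᶠ a))) (+-≡0 (multiple≡0 a refl ℓ≡0) (multiple≡0 (-ᶠ (K *ᶠ a)) refl c≡-Ka)) ,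
    ℓ≡0 , ℓ≡0
    where
    ℓ≡0 : ℓ a a (-ᶠ (K *ᶠ a)) ≡ 0ᶠ
    ℓ≡0 = trans (ℓ-diagonal a) (multiple≡0 a refl Ka≡μ)

  origin∧apex⇒K≡-1 : ∀ {a b c} → Origin a b c → Apex a b c → K +ᶠ 1ᶠ ≡ 0ᶠ
  origin∧apex⇒K≡-1 (refl , refl , refl) (_ , K0≡μ , _) = *-cancel-0 κ≢0
    (trans (sym (-‿≡0⇒≡ K0≡μ)) (multiple≡0 K refl refl))

  apex⇒origin : ∀ {a b c} → K +ᶠ 1ᶠ ≡ 0ᶠ → Apex a b c → Origin a b c
  apex⇒origin {a} {b} {c} K≡-1 (b≡a , Ka≡μ , c≡-Ka) =
    a≡0 , trans (-‿≡0⇒≡ b≡a) a≡0 ,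
    trans (solve 2 (λ c u → c := c :+ u :- u) refl c (K *ᶠ a)) (≡⇒-‿≡0 (trans c≡-Ka (sym (multiple≡0 K refl a≡0))))
    where
    a≡0 : a ≡ 0ᶠ
    a≡0 = trans (solve 3 (λ K a v → a := (K :+ con 1ℤ) :* (a :- v) :- (K :* a :- v :* (K :+ con 1ℤ))) refl K a κ)
      (≡⇒-‿≡0 (trans (multiple≡0 (a +ᶠ -ᶠ κ) (solve 2 (λ x y → x :* y := y :* x) refl _ _) K≡-1) (sym Ka≡μ)))

  -- At `K = -1` the apex is the origin, and the factor `1 - δ (K + 1)` prevents counting it twice;
  -- for other `K` the two conditions exclude each other.
  fixedByTwo-𝟙 : ∀ a b c → 𝟙 (fixedByTwo? a b c) ≡
    𝟙 (origin? a b c) + (1ℤ - δ (K +ᶠ 1ᶠ)) * 𝟙 (apex? a b c)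
  fixedByTwo-𝟙 a b c = go (origin? a b c) (apex? a b c) (K +ᶠ 1ᶠ ≟ᶠ 0ᶠ)
    where
    go : (o? : Dec (Origin a b c)) (a? : Dec (Apex a b c)) (k? : Dec (K +ᶠ 1ᶠ ≡ 0ᶠ)) →
      𝟙 (fixedByTwo? a b c) ≡ 𝟙 o? + (1ℤ - 𝟙 k?) * 𝟙 a?
    go (yes o) (yes a) (yes _)  = 𝟙-yes (fixedByTwo? _ _ _) (origin⇒fixedByTwo o)
    go (yes o) (yes a) (no k)   = ⊥-elim (k (origin∧apex⇒K≡-1 o a))
    go (yes o) (no _)  (yes _)  = 𝟙-yes (fixedByTwo? _ _ _) (origin⇒fixedByTwo o)
    go (yes o) (no _)  (no _)   = 𝟙-yes (fixedByTwo? _ _ _) (origin⇒fixedByTwo o)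
    go (no ¬o) (yes a) (yes k)  = ⊥-elim (¬o (apex⇒origin k a))
    go (no _)  (yes a) (no _)   = 𝟙-yes (fixedByTwo? _ _ _) (apex⇒fixedByTwo a)
    go (no ¬o) (no ¬a) k?       = trans (𝟙-no (fixedByTwo? _ _ _) (neither ∘ fixedByTwo⇒)) (sym (trans (ℤ.+-identityˡ _) (ℤ.*-zeroʳ (1ℤ - 𝟙 k?))))
      where
      neither : ¬ (Origin a b c ⊎ Apex a b c)
      neither (inj₁ o) = ¬o o
      neither (inj₂ a) = ¬a a

  -- For the indicator of a set in which `a` determines both `b` and `c`: the inner sums collapse to
  -- 1. The order of the factors is that of the conditions in `Apex`.
  sum₃-product : (f : Fin p → ℤ) (g h : Fin p → Fin p → ℤ) →
    (∀ a → sum (g a) ≡ 1ℤ) → (∀ a → sum (h a) ≡ 1ℤ) →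
    sum₃ (λ a b c → g a b * (f a * h a c)) ≡ sum f
  sum₃-product f g h sg sh = sum-cong-≗ λ a → begin
    sum (λ b → sum (λ c → g a b * (f a * h a c)))    ≡⟨ sum-cong-≗ (λ b → sum-cong-≗ λ c → eq (g a b) (f a) (h a c)) ⟩
    sum (λ b → sum (λ c → f a * g a b * h a c))      ≡⟨ sum-cong-≗ (λ b → trans (sym (*-distribˡ-sum (f a * g a b) (h a))) (trans (cong (f a * g a b *_) (sh a)) (ℤ.*-identityʳ _))) ⟩
    sum (λ b → f a * g a b)                          ≡⟨ trans (sym (*-distribˡ-sum (f a) (g a))) (trans (cong (f a *_) (sg a)) (ℤ.*-identityʳ _)) ⟩
    f a                                              ∎
    where
    open ≡-Reasoning
    eq : ∀ x y z → x * (y * z) ≡ y * x * z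
    eq = solve-∀

  sum-origin : sum₃ (λ a b c → 𝟙 (origin? a b c)) ≡ 1ℤ
  sum-origin = begin
    sum₃ (λ a b c → 𝟙 (origin? a b c))        ≡⟨ sum₃-cong (λ a b c → trans (𝟙-× (a ≟ᶠ 0ᶠ) (b ≟ᶠ 0ᶠ ×-dec c ≟ᶠ 0ᶠ)) (trans (cong (δ a *_) (𝟙-× (b ≟ᶠ 0ᶠ) (c ≟ᶠ 0ᶠ))) (eq (δ a) (δ b) (δ c)))) ⟩
    sum₃ (λ a b c → δ b * (δ a * δ c))        ≡⟨ sum₃-product δ (λ _ → δ) (λ _ → δ) (λ _ → sum-δ) (λ _ → sum-δ) ⟩
    sum δ                                     ≡⟨ sum-δ ⟩
    1ℤ                                        ∎
    where
    open ≡-Reasoning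
    eq : ∀ x y z → x * (y * z) ≡ y * (x * z)
    eq = solve-∀

  sum-apex : sum₃ (λ a b c → 𝟙 (apex? a b c)) ≡ 1ℤ - δ K
  sum-apex = begin
    sum₃ (λ a b c → 𝟙 (apex? a b c))          ≡⟨ sum₃-cong (λ a b c → trans (𝟙-× (b +ᶠ -ᶠ a ≟ᶠ 0ᶠ) (K *ᶠ a +ᶠ -ᶠ μ ≟ᶠ 0ᶠ ×-dec c +ᶠ K *ᶠ a ≟ᶠ 0ᶠ))
                                                   (cong (δ (b +ᶠ -ᶠ a) *_) (𝟙-× (K *ᶠ a +ᶠ -ᶠ μ ≟ᶠ 0ᶠ) (c +ᶠ K *ᶠ a ≟ᶠ 0ᶠ)))) ⟩
    sum₃ (λ a b c → δ (b +ᶠ -ᶠ a) * (δ (K *ᶠ a +ᶠ -ᶠ μ) * δ (c +ᶠ K *ᶠ a)))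
                                              ≡⟨ sum₃-product (λ a → δ (K *ᶠ a +ᶠ -ᶠ μ)) (λ a b → δ (b +ᶠ -ᶠ a)) (λ a c → δ (c +ᶠ K *ᶠ a))
                                                   sum-δ- (λ a → trans (sum-shift (K *ᶠ a) δ) sum-δ) ⟩
    sum (λ a → δ (K *ᶠ a +ᶠ -ᶠ μ))            ≡⟨ last ⟩
    1ℤ - δ K                                  ∎
    where
    open ≡-Reasoning
    last : sum (λ a → δ (K *ᶠ a +ᶠ -ᶠ μ)) ≡ 1ℤ - δ K
    last with K ≟ᶠ 0ᶠ
    ... | no K≢0  = sum-δ-linear (-ᶠ μ) K≢0
    ... | yes K≡0 = trans (sum-cong-≗ λ a → δ-≢0 (-μ≢0 a)) (trans (sum-const p 0ℤ) (ℤ.*-zeroʳ (+ p)))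
      where
      -μ≢0 : ∀ a → K *ᶠ a +ᶠ -ᶠ μ ≢ 0ᶠ
      -- At `K = 0` the left side `K a - μ` is `-μ = 2`; the identity subtracts the multiple of `K`
      -- by which they differ in general.
      -μ≢0 a e = 2≢0 (begin
        ι (+ 2)                                              ≡⟨ solve 2 (λ K a → con (+ 2) := (K :* a :- (K :- con (+ 2)) :* (K :+ con 1ℤ)) :- K :* (a :+ con 1ℤ :- K)) refl K a ⟩
        K *ᶠ a +ᶠ -ᶠ μ +ᶠ -ᶠ (K *ᶠ (a +ᶠ 1ᶠ +ᶠ -ᶠ K))        ≡⟨ ≡⇒-‿≡0 (trans e (sym (multiple≡0 (a +ᶠ 1ᶠ +ᶠ -ᶠ K) (solve 2 (λ x y → x :* y := y :* x) refl _ _) K≡0))) ⟩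
        0ᶠ                                                   ∎)

  -- The number of points other than the origin fixed by two given flips.
  n₁ : ℤ
  n₁ = (1ℤ - δ (K +ᶠ 1ᶠ)) * (1ℤ - δ K)

  fixed-by-two : sum₃ (λ a b c → δ (q a b c) * (δ (ℓ a b c) * δ (ℓ b a c))) ≡
    1ℤ + n₁
  fixed-by-two = begin
    sum₃ (λ a b c → δ (q a b c) * (δ (ℓ a b c) * δ (ℓ b a c)))
      ≡⟨ sum₃-cong (λ a b c → trans (sym (trans (𝟙-× (q a b c ≟ᶠ 0ᶠ) (ℓ a b c ≟ᶠ 0ᶠ ×-dec ℓ b a c ≟ᶠ 0ᶠ)) (cong (δ (q a b c) *_) (𝟙-× (ℓ a b c ≟ᶠ 0ᶠ) (ℓ b a c ≟ᶠ 0ᶠ)))))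
                                    (fixedByTwo-𝟙 a b c)) ⟩
    sum₃ (λ a b c → 𝟙 (origin? a b c) + t * 𝟙 (apex? a b c))
      ≡⟨ sum₃-distrib-+ (λ a b c → 𝟙 (origin? a b c)) (λ a b c → t * 𝟙 (apex? a b c)) ⟩
    sum₃ (λ a b c → 𝟙 (origin? a b c)) + sum₃ (λ a b c → t * 𝟙 (apex? a b c))
      ≡⟨ cong₂ _+_ sum-origin (trans (sum₃-distribˡ-* t (λ a b c → 𝟙 (apex? a b c))) (cong (t *_) sum-apex)) ⟩
    1ℤ + t * (1ℤ - δ K) ∎
    where
    open ≡-Reasoning
    t = 1ℤ - δ (K +ᶠ 1ᶠ)

  fixed-by-three : sum₃ (λ a b c → δ (q a b c) * (δ (ℓ a b c) * δ (ℓ b a c) * δ (ℓ c a b))) ≡ 1ℤ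
  fixed-by-three = trans (sum₃-cong term) sum-origin
    where
    only-origin : ∀ {a b c} → FixedByTwo a b c → ℓ c a b ≡ 0ᶠ → Origin a b c
    only-origin {a} {b} {c} fixed ℓ≡0 with fixedByTwo⇒ fixed
    ... | inj₁ o = o
    ... | inj₂ (b≡a , Ka≡μ , c≡-Ka)
      with refl ← -‿≡0⇒≡ b≡a
      with refl ← -‿≡0⇒≡ (trans (solve 2 (λ c u → c :- (:- u) := c :+ u) refl c (K *ᶠ a)) c≡-Ka) =
      a≡0 , a≡0 , multiple≡0 (-ᶠ K) (solve 2 (λ K a → :- (K :* a) := :- K :* a) refl K a) a≡0
      where
      a≡0 : a ≡ 0ᶠ
      -- At the apex `(a, a, -K a)` the third form `ℓ c a b` equals `-a²`, so the third flip moves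
      -- it unless it is the origin.
      a≡0 = x*x≡0⇒x≡0 (multiple≡0 (-ᶠ 1ᶠ) (solve 2 (λ K a → a :* a :=
        :- con 1ℤ :* (con (+ 2) :* (:- (K :* a)) :+ (K :* (a :+ a) :- a :* a))) refl K a) ℓ≡0)
    term : ∀ a b c → δ (q a b c) * (δ (ℓ a b c) * δ (ℓ b a c) * δ (ℓ c a b)) ≡ 𝟙 (origin? a b c)
    term a b c = trans (sym (trans (𝟙-× (fixedByTwo? a b c) (ℓ c a b ≟ᶠ 0ᶠ))
      (trans (cong (_* δ (ℓ c a b)) (trans (𝟙-× (q a b c ≟ᶠ 0ᶠ) (ℓ a b c ≟ᶠ 0ᶠ ×-dec ℓ b a c ≟ᶠ 0ᶠ)) (cong (δ (q a b c) *_) (𝟙-× (ℓ a b c ≟ᶠ 0ᶠ) (ℓ b a c ≟ᶠ 0ᶠ)))))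
             (ℤ.*-assoc (δ (q a b c)) (δ (ℓ a b c) * δ (ℓ b a c)) (δ (ℓ c a b))))))
      (𝟙-cong (fixedByTwo? a b c ×-dec ℓ c a b ≟ᶠ 0ᶠ) (origin? a b c)
        (λ (f , ℓ≡0) → only-origin f ℓ≡0)
        (λ { o@(refl , refl , refl) → origin⇒fixedByTwo o , proj₁ (proj₂ (origin⇒fixedByTwo o)) }))

  -- Symmetry in the coordinates and the weighted count.

  q-swap : ∀ a b c → q b a c ≡ q a b c
  q-swap a b c = solve 4 (λ K a b c →
    con 1ℤ :* (b :* b) :+ (K :* (a :+ c) :- a :* c) :* b :+ (a :* a :+ c :* c :+ K :* (a :* c)) :=
    con 1ℤ :* (a :* a) :+ (K :* (b :+ c) :- b :* c) :* a :+ (b :* b :+ c :* c :+ K :* (b :* c))) refl K a b c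

  q-swap′ : ∀ a b c → q a c b ≡ q a b c
  q-swap′ a b c = solve 4 (λ K a b c →
    con 1ℤ :* (a :* a) :+ (K :* (c :+ b) :- c :* b) :* a :+ (c :* c :+ b :* b :+ K :* (c :* b)) :=
    con 1ℤ :* (a :* a) :+ (K :* (b :+ c) :- b :* c) :* a :+ (b :* b :+ c :* c :+ K :* (b :* c))) refl K a b c

  ℓ-swap : ∀ a b c → ℓ a c b ≡ ℓ a b c
  ℓ-swap a b c = solve 4 (λ K a b c →
    con (+ 2) :* a :+ (K :* (c :+ b) :- c :* b) := con (+ 2) :* a :+ (K :* (b :+ c) :- b :* c)) refl K a b c

  -- Permuting the coordinates preserves `q` and permutes the three forms `ℓ`, so every single flip
  -- contributes as the first one does and every pair as the first pair does; hence the two factors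
  -- 3.
  sum₃-weigh : ∀ x y z →
    sum₃ (λ a b c → δ (q a b c) * weigh x y z (δ (ℓ a b c)) (δ (ℓ b a c)) (δ (ℓ c a b))) ≡
    + 3 * x * (+ p - + 3 - s₋) + + 3 * y * (1ℤ + n₁) + z
  sum₃-weigh x y z = begin
    sum₃ (λ a b c → s a b c * weigh x y z (e₁ a b c) (e₂ a b c) (e₃ a b c))
      ≡⟨ sum₃-cong (λ a b c → expand (s a b c) (e₁ a b c) (e₂ a b c) (e₃ a b c)) ⟩
    sum₃ (λ a b c → x * (f₁ a b c + f₂ a b c + f₃ a b c) + y * (g₁ a b c + g₂ a b c + g₃ a b c) + z * h a b c)
      ≡⟨ sum₃-distrib-+ (λ a b c → x * (f₁ a b c + f₂ a b c + f₃ a b c) + y * (g₁ a b c + g₂ a b c + g₃ a b c)) (λ a b c → z * h a b c) ⟩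
    sum₃ (λ a b c → x * (f₁ a b c + f₂ a b c + f₃ a b c) + y * (g₁ a b c + g₂ a b c + g₃ a b c)) + sum₃ (λ a b c → z * h a b c)
      ≡⟨ cong₂ _+_ (trans (sum₃-distrib-+ (λ a b c → x * (f₁ a b c + f₂ a b c + f₃ a b c)) (λ a b c → y * (g₁ a b c + g₂ a b c + g₃ a b c)))
                          (cong₂ _+_ (sum₃-triple x f₁ f₂ f₃) (sum₃-triple y g₁ g₂ g₃)))
                   (sum₃-distribˡ-* z h) ⟩
    x * (sum₃ f₁ + sum₃ f₂ + sum₃ f₃) + y * (sum₃ g₁ + sum₃ g₂ + sum₃ g₃) + z * sum₃ h
      ≡⟨ cong₂ (λ u v → x * u + y * v + z * sum₃ h)
               (cong₂ _+_ (cong₂ _+_ fixed-by-one (trans f₂≡f₁ fixed-by-one)) (trans f₃≡f₁ fixed-by-one))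
               (cong₂ _+_ (cong₂ _+_ fixed-by-two (trans g₂≡g₁ fixed-by-two)) (trans g₃≡g₁ fixed-by-two)) ⟩
    x * (S₁ + S₁ + S₁) + y * (S₂ + S₂ + S₂) + z * sum₃ h
      ≡⟨ cong (λ t → x * (S₁ + S₁ + S₁) + y * (S₂ + S₂ + S₂) + z * t) fixed-by-three ⟩
    x * (S₁ + S₁ + S₁) + y * (S₂ + S₂ + S₂) + z * 1ℤ
      ≡⟨ collect x y z S₁ S₂ ⟩
    + 3 * x * S₁ + + 3 * y * S₂ + z ∎
    where
    open ≡-Reasoning
    S₁ = + p - + 3 - s₋
    S₂ = 1ℤ + n₁
    s e₁ e₂ e₃ f₁ f₂ f₃ g₁ g₂ g₃ h : Fin p → Fin p → Fin p → ℤ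
    s a b c  = δ (q a b c)
    e₁ a b c = δ (ℓ a b c)
    e₂ a b c = δ (ℓ b a c)
    e₃ a b c = δ (ℓ c a b)
    f₁ a b c = s a b c * e₁ a b c
    f₂ a b c = s a b c * e₂ a b c
    f₃ a b c = s a b c * e₃ a b c
    g₁ a b c = s a b c * (e₁ a b c * e₂ a b c)
    g₂ a b c = s a b c * (e₁ a b c * e₃ a b c)
    g₃ a b c = s a b c * (e₂ a b c * e₃ a b c)
    h a b c  = s a b c * (e₁ a b c * e₂ a b c * e₃ a b c)
    expand : ∀ s e₁ e₂ e₃ → s * weigh x y z e₁ e₂ e₃ ≡
      x * (s * e₁ + s * e₂ + s * e₃) + y * (s * (e₁ * e₂) + s * (e₁ * e₃) + s * (e₂ * e₃)) + z * (s * (e₁ * e₂ * e₃))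
    expand = eq x y z
      where
      eq : ∀ x y z s e₁ e₂ e₃ → s * (x * (e₁ + e₂ + e₃) + y * (e₁ * e₂ + e₁ * e₃ + e₂ * e₃) + z * (e₁ * e₂ * e₃)) ≡
        x * (s * e₁ + s * e₂ + s * e₃) + y * (s * (e₁ * e₂) + s * (e₁ * e₃) + s * (e₂ * e₃)) + z * (s * (e₁ * e₂ * e₃))
      eq = solve-∀
    collect : ∀ x y z u v → x * (u + u + u) + y * (v + v + v) + z * 1ℤ ≡ + 3 * x * u + + 3 * y * v + z
    collect = solve-∀
    sum₃-triple : ∀ k f g h → sum₃ (λ a b c → k * (f a b c + g a b c + h a b c)) ≡ k * (sum₃ f + sum₃ g + sum₃ h)
    sum₃-triple k f g h = trans (sum₃-distribˡ-* k (λ a b c → f a b c + g a b c + h a b c)) (cong (k *_)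
      (trans (sum₃-distrib-+ (λ a b c → f a b c + g a b c) h) (cong (_+ sum₃ h) (sum₃-distrib-+ f g))))
    f₂≡f₁ : sum₃ f₂ ≡ sum₃ f₁
    f₂≡f₁ = trans (sum₃-swap f₂) (sum₃-cong λ a b c → cong (λ u → δ u * e₁ a b c) (q-swap a b c))
    f₃≡f₁ : sum₃ f₃ ≡ sum₃ f₁
    f₃≡f₁ = trans (sum₃-rotate f₃) (trans (sum₃-rotate (λ b c a → f₃ a b c))
      (sum₃-cong λ a b c → cong (λ u → δ u * e₁ a b c) (trans (q-swap′ b a c) (q-swap a b c))))
    g₂≡g₁ : sum₃ g₂ ≡ sum₃ g₁
    g₂≡g₁ = trans (sum-cong-≗ λ a → ∑-comm (g₂ a))
      (sum₃-cong λ a b c → cong₂ (λ u v → δ u * (δ v * e₂ a b c)) (q-swap′ a b c) (ℓ-swap a b c))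
    g₃≡g₁ : sum₃ g₃ ≡ sum₃ g₁
    g₃≡g₁ = trans (sum₃-rotate g₃) (sum₃-cong λ a b c → cong₂ _*_
      (cong δ (trans (q-swap a c b) (q-swap′ a b c)))
      (cong₂ (λ u v → δ u * δ v) (ℓ-swap a b c) (ℓ-swap b a c)))

  -- The signs and the numbers `n₀`, `n₁` in the three cases.

  K≡0-values : K ≡ ι (+ 0) → s₊ ≡ σ (ι (- (+ 1))) × s₋ ≡ σ (ι (- (+ 1))) × n₀ ≡ + 3 × n₁ ≡ 0ℤ
  K≡0-values K≡0 =
    trans (cong σ (trans (cong (λ K → (K +ᶠ -ᶠ ι (+ 2)) *ᶠ (K +ᶠ ι (+ 2))) K≡0)
      (solve 0 ((con 0ℤ :- con (+ 2)) :* (con 0ℤ :+ con (+ 2)) := con (+ 2) :* con (+ 2) :* con (- (+ 1))) refl)))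
      (σ-square-* (ι (+ 2)) (ι (- (+ 1))) 2≢0) ,
    cong σ (trans (cong (λ K → -ᶠ K +ᶠ -ᶠ 1ᶠ) K≡0) (solve 0 (:- con 0ℤ :- con 1ℤ := con (- (+ 1))) refl)) ,
    cong (λ d → + 3 - d) (δ-≢0 K≢-1) ,
    cong₂ (λ d e → (1ℤ - d) * (1ℤ - e)) (δ-≢0 K≢-1) (δ-≡0 K≡0)
    where
    K≢-1 : K +ᶠ 1ᶠ ≢ 0ᶠ
    K≢-1 K≡-1 = 1≢0 (trans (solve 1 (λ K → con 1ℤ := K :+ con 1ℤ :- K) refl K) (≡⇒-‿≡0 (trans K≡-1 (sym K≡0))))

  K≡-1-values : K ≡ ι (- (+ 1)) → s₊ ≡ σ (ι (- (+ 3))) × s₋ ≡ 0ℤ × n₀ ≡ + 2 × n₁ ≡ 0ℤ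
  K≡-1-values K≡-1 =
    cong σ (trans (cong (λ K → (K +ᶠ -ᶠ ι (+ 2)) *ᶠ (K +ᶠ ι (+ 2))) K≡-1)
      (solve 0 ((con (- (+ 1)) :- con (+ 2)) :* (con (- (+ 1)) :+ con (+ 2)) := con (- (+ 3))) refl)) ,
    σ-zero (trans (cong (λ K → -ᶠ K +ᶠ -ᶠ 1ᶠ) K≡-1) (solve 0 (:- con (- (+ 1)) :- con 1ℤ := con 0ℤ) refl)) ,
    cong (λ d → + 3 - d) (δ-≡0 K+1≡0) ,
    trans (cong (λ d → (1ℤ - d) * (1ℤ - δ K)) (δ-≡0 K+1≡0)) (ℤ.*-zeroˡ (1ℤ - δ K))
    where
    K+1≡0 : K +ᶠ 1ᶠ ≡ 0ᶠ
    K+1≡0 = trans (cong (_+ᶠ 1ᶠ) K≡-1) (solve 0 (con (- (+ 1)) :+ con 1ℤ := con 0ℤ) refl)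

  generic-values : K ≢ ι (+ 0) → K ≢ ι (- (+ 1)) → s₊ ≡ σ (K *ᶠ K +ᶠ -ᶠ ι (+ 4)) × n₀ ≡ + 3 × n₁ ≡ 1ℤ
  generic-values K≢0 K≢-1 =
    cong σ (solve 1 (λ K → (K :- con (+ 2)) :* (K :+ con (+ 2)) := K :* K :- con (+ 4)) refl K) ,
    cong (λ d → + 3 - d) (δ-≢0 K+1≢0) ,
    cong₂ (λ d e → (1ℤ - d) * (1ℤ - e)) (δ-≢0 K+1≢0) (δ-≢0 K≢0)
    where
    K+1≢0 : K +ᶠ 1ᶠ ≢ 0ᶠ
    K+1≢0 e = K≢-1 (-‿≡0⇒≡ (trans (solve 1 (λ K → K :- con (- (+ 1)) := K :+ con 1ℤ) refl K) e))

-- The Vieta equation and its flips in the shifted coordinates.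

module VietaEquation {p : ℕ} (F : OddField p) (K : Fin p)
  (K≢2 : K ≢ OddField.ι F (+ 2)) (K≢-2 : K ≢ OddField.ι F (- (+ 2))) (C D : Fin p)
  (C-def : C ≡ OddField._+ᶠ_ F (OddField._*ᶠ_ F K K) (OddField._*ᶠ_ F (OddField.ι F (+ 2)) K))
  (D-def : D ≡ OddField.-ᶠ_ F (OddField._+ᶠ_ F
    (OddField._*ᶠ_ F (OddField.ι F (+ 2)) (OddField._*ᶠ_ F (OddField._*ᶠ_ F K K) K))
    (OddField._*ᶠ_ F (OddField.ι F (+ 3)) (OddField._*ᶠ_ F K K)))) where
  open OddField F
  open QuadraticSums F
  open ShiftedSurface F K K≢2 K≢-2

  lhs rhs defect flip displacement : Fin p → Fin p → Fin p → Fin p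
  lhs x y z  = x *ᶠ x +ᶠ y *ᶠ y +ᶠ z *ᶠ z
  rhs x y z  = x *ᶠ y *ᶠ z +ᶠ -ᶠ (C *ᶠ (x +ᶠ y +ᶠ z)) +ᶠ D
  defect x y z = lhs x y z +ᶠ -ᶠ rhs x y z
  flip x y z = y *ᶠ z +ᶠ -ᶠ C +ᶠ -ᶠ x
  displacement x y z = x +ᶠ -ᶠ flip x y z

  shift : Fin p → Fin p
  shift a = a +ᶠ -ᶠ K

  -- The surface has the singular point (-K, -K, -K); moving it to the origin leaves only terms
  -- of degree 2 and 3.
  equation-shift : ∀ a b c →
    defect (shift a) (shift b) (shift c) ≡ q a b c
  equation-shift a b c = trans
    (cong₂ (λ C D → let x = shift a
                        y = shift b
                        z = shift c
      in x *ᶠ x +ᶠ y *ᶠ y +ᶠ z *ᶠ z +ᶠ -ᶠ (x *ᶠ y *ᶠ z +ᶠ -ᶠ (C *ᶠ (x +ᶠ y +ᶠ z)) +ᶠ D)) C-def D-def)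
    (solve 4 (λ K a b c →
    let x = a :- K
        y = b :- K
        z = c :- K
        C = K :* K :+ con (+ 2) :* K
        D = :- (con (+ 2) :* (K :* K :* K) :+ con (+ 3) :* (K :* K))
    in x :* x :+ y :* y :+ z :* z :- (x :* y :* z :- C :* (x :+ y :+ z) :+ D) :=
       con 1ℤ :* (a :* a) :+ (K :* (b :+ c) :- b :* c) :* a :+ (b :* b :+ c :* c :+ K :* (b :* c))) refl K a b c)

  flip-shift : ∀ a b c → displacement (shift a) (shift b) (shift c) ≡ ℓ a b c
  flip-shift a b c = trans
    (cong (λ C → shift a +ᶠ -ᶠ (shift b *ᶠ shift c +ᶠ -ᶠ C +ᶠ -ᶠ shift a)) C-def)
    (solve 4 (λ K a b c →
    (a :- K) :- ((b :- K) :* (c :- K) :- (K :* K :+ con (+ 2) :* K) :- (a :- K)) :=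
    con (+ 2) :* a :+ (K :* (b :+ c) :- b :* c)) refl K a b c)

  flip-involutive : ∀ x y z → flip (flip x y z) y z ≡ x
  flip-involutive x y z = solve 4 (λ C x y z → y :* z :- C :- (y :* z :- C :- x) := x) refl C x y z

  -- The defect is monic quadratic in `x` with linear coefficient `C - yz`, so it takes the same
  -- value at `x` and at `yz - C - x`, on the surface and off it.
  flip₁-equation : ∀ x y z → defect (flip x y z) y z ≡ defect x y z
  flip₁-equation = solve 5 (λ C D x y z →
    let x′ = y :* z :- C :- x
    in x′ :* x′ :+ y :* y :+ z :* z :- (x′ :* y :* z :- C :* (x′ :+ y :+ z) :+ D) :=
       x :* x :+ y :* y :+ z :* z :- (x :* y :* z :- C :* (x :+ y :+ z) :+ D)) refl C D

  flip₂-equation : ∀ x y z → defect x (flip y x z) z ≡ defect x y z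
  flip₂-equation = solve 5 (λ C D x y z →
    let y′ = x :* z :- C :- y
    in x :* x :+ y′ :* y′ :+ z :* z :- (x :* y′ :* z :- C :* (x :+ y′ :+ z) :+ D) :=
       x :* x :+ y :* y :+ z :* z :- (x :* y :* z :- C :* (x :+ y :+ z) :+ D)) refl C D

  flip₃-equation : ∀ x y z → defect x y (flip z x y) ≡ defect x y z
  flip₃-equation = solve 5 (λ C D x y z →
    let z′ = x :* y :- C :- z
    in x :* x :+ y :* y :+ z′ :* z′ :- (x :* y :* z′ :- C :* (x :+ y :+ z′) :+ D) :=
       x :* x :+ y :* y :+ z :* z :- (x :* y :* z :- C :* (x :+ y :+ z) :+ D)) refl C D

  sum₃-shift : ∀ f → sum₃ (λ a b c → f (shift a) (shift b) (shift c)) ≡ sum₃ f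
  sum₃-shift f = trans
    (sum-cong-≗ λ a → trans
      (sum-cong-≗ λ b → sum-shift (-ᶠ K) (f (shift a) (shift b)))
      (sum-shift (-ᶠ K) (λ y → sum (f (shift a) y))))
    (sum-shift (-ᶠ K) (λ x → sum λ y → sum (f x y)))

open import Defs

-- The residues modulo `p` as a field of odd characteristic.

module Residues {p : ℕ} .{{_ : NonZero p}} where

  -- For `m ≥ 0` both sides are natural numbers and can be reduced modulo `p`. For negative `m` the
  -- multiple moves to the other side and the roles of `r` and `s` are exchanged.
  residue-unique : ∀ {r s} m → r < p → s < p → + r ≡ + s + m * + p → r ≡ s
  residue-unique {r} {s} (+ n) r<p s<p eq = begin
    r                      ≡⟨ ℕ.m<n⇒m%n≡m r<p ⟨
    r ℕ.% p                ≡⟨ cong (ℕ._% p) (ℤ.+-injective (trans eq (sym (trans (ℤ.pos-+ s (n ℕ.* p)) (cong (λ t → + s + t) (ℤ.pos-* n p)))))) ⟩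
    (s ℕ.+ n ℕ.* p) ℕ.% p  ≡⟨ ℕ.[m+kn]%n≡m%n s n p ⟩
    s ℕ.% p                ≡⟨ ℕ.m<n⇒m%n≡m s<p ⟩
    s                      ∎
    where open ≡-Reasoning
  residue-unique {r} {s} m@(-[1+ n ]) r<p s<p eq = sym (residue-unique (+ (ℕ.suc n)) s<p r<p (begin
    + s                             ≡⟨ move (+ s) m (+ p) ⟩
    + s + m * + p + (- m) * + p     ≡⟨ cong (_+ (- m) * + p) eq ⟨
    + r + (- m) * + p               ∎))
    where
    open ≡-Reasoning
    move : ∀ s m q → s ≡ s + m * q + (- m) * q
    move = solve-∀

  -- The multiple `k` is explicit, so that compatibility with each ring operation becomes an integer
  -- identity for the solver.
  fromℤ-cong : ∀ i j k → i ≡ j + k * + p → fromℤ i ≡ fromℤ j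
  fromℤ-cong i j k eq = toℕ-injective (begin
    toℕ (fromℤ i)  ≡⟨ toℕ-fromℕ< (n%ℕd<d i p) ⟩
    i %ℕ p         ≡⟨ residue-unique (j /ℕ p + k - i /ℕ p) (n%ℕd<d i p) (n%ℕd<d j p) (begin
                        + (i %ℕ p)                                                      ≡⟨ move (+ (i %ℕ p)) (i /ℕ p) (+ p) ⟩
                        + (i %ℕ p) + i /ℕ p * + p - i /ℕ p * + p                        ≡⟨ cong (_- i /ℕ p * + p) (trans (sym (a≡a%ℕn+[a/ℕn]*n i p)) (trans eq (cong (_+ k * + p) (a≡a%ℕn+[a/ℕn]*n j p)))) ⟩
                        + (j %ℕ p) + j /ℕ p * + p + k * + p - i /ℕ p * + p              ≡⟨ collect (+ (j %ℕ p)) (j /ℕ p) k (i /ℕ p) (+ p) ⟩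
                        + (j %ℕ p) + (j /ℕ p + k - i /ℕ p) * + p                        ∎) ⟩
    j %ℕ p         ≡⟨ toℕ-fromℕ< (n%ℕd<d j p) ⟨
    toℕ (fromℤ j)  ∎)
    where
    open ≡-Reasoning
    move : ∀ r u q → r ≡ r + u * q - u * q
    move = solve-∀
    collect : ∀ s v k u q → s + v * q + k * q - u * q ≡ s + (v + k - u) * q
    collect = solve-∀

  fromℤ-small : ∀ {n} → n < p → toℕ (fromℤ {p} (+ n)) ≡ n
  fromℤ-small {n} n<p = trans (toℕ-fromℕ< (n%ℕd<d (+ n) p)) (ℕ.m<n⇒m%n≡m n<p)

  fromℤ-toℤ : ∀ a → fromℤ (toℤ a) ≡ a
  fromℤ-toℤ a = toℕ-injective (fromℤ-small (toℕ<n a))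

  toℤ-fromℤ : ∀ i → i ≡ toℤ (fromℤ i) + i /ℕ p * + p
  toℤ-fromℤ i = trans (a≡a%ℕn+[a/ℕn]*n i p) (cong (λ r → + r + i /ℕ p * + p) (sym (toℕ-fromℕ< (n%ℕd<d i p))))

  fromℤ-+ : ∀ i j → fromℤ (i + j) ≡ fromℤ i +ᶠ fromℤ j
  fromℤ-+ i j = fromℤ-cong (i + j) (toℤ (fromℤ i) + toℤ (fromℤ j)) (i /ℕ p + j /ℕ p)
    (trans (cong₂ _+_ (toℤ-fromℤ i) (toℤ-fromℤ j)) (eq (toℤ (fromℤ i)) (i /ℕ p) (toℤ (fromℤ j)) (j /ℕ p) (+ p)))
    where
    eq : ∀ r u s v q → r + u * q + (s + v * q) ≡ r + s + (u + v) * q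
    eq = solve-∀

  fromℤ-* : ∀ i j → fromℤ (i * j) ≡ fromℤ i *ᶠ fromℤ j
  fromℤ-* i j = fromℤ-cong (i * j) (toℤ (fromℤ i) * toℤ (fromℤ j)) (toℤ (fromℤ i) * (j /ℕ p) + i /ℕ p * toℤ (fromℤ j) + i /ℕ p * (j /ℕ p) * + p)
    (trans (cong₂ _*_ (toℤ-fromℤ i) (toℤ-fromℤ j)) (eq (toℤ (fromℤ i)) (i /ℕ p) (toℤ (fromℤ j)) (j /ℕ p) (+ p)))
    where
    eq : ∀ r u s v q → (r + u * q) * (s + v * q) ≡ r * s + (r * v + u * s + u * v * q) * q
    eq = solve-∀

  fromℤ-neg : ∀ i → fromℤ (- i) ≡ -ᶠ fromℤ i
  fromℤ-neg i = fromℤ-cong (- i) (- toℤ (fromℤ i)) (- (i /ℕ p)) (trans (cong -_ (toℤ-fromℤ i)) (eq (toℤ (fromℤ i)) (i /ℕ p) (+ p)))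
    where
    eq : ∀ r u q → - (r + u * q) ≡ - r + (- u) * q
    eq = solve-∀

  -ᶠ≡+ᶠ-ᶠ : ∀ a b → a -ᶠ b ≡ a +ᶠ -ᶠ b
  -ᶠ≡+ᶠ-ᶠ a b = begin
    fromℤ (toℤ a + - toℤ b)            ≡⟨ fromℤ-+ (toℤ a) (- toℤ b) ⟩
    fromℤ (toℤ a) +ᶠ fromℤ (- toℤ b)   ≡⟨ cong (_+ᶠ -ᶠ b) (fromℤ-toℤ a) ⟩
    a +ᶠ -ᶠ b                          ∎
    where open ≡-Reasoning

  fromℤ-surjective : (P : 𝔽 p → Set) → (∀ i → P (fromℤ i)) → ∀ a → P a
  fromℤ-surjective P f a = subst P (fromℤ-toℤ a) (f (toℤ a))

  -- Each ring law holds on the image of the surjective map fromℤ because it holds in ℤ.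
  isCommutativeRing : IsCommutativeRing _≡_ (_+ᶠ_ {p}) _*ᶠ_ (λ a → -ᶠ a) (fromℤ 0ℤ) (fromℤ 1ℤ)
  isCommutativeRing = record
    { isRing = record
      { +-isAbelianGroup = record
        { isGroup = record
          { isMonoid = record
            { isSemigroup = record
              { isMagma = record { isEquivalence = isEquivalence ; ∙-cong = cong₂ _+ᶠ_ }
              ; assoc = +ᶠ-assoc }
            ; identity = +ᶠ-identityˡ , λ a → trans (+ᶠ-comm a (fromℤ 0ℤ)) (+ᶠ-identityˡ a) }
          ; inverse = -ᶠ-inverseˡ , λ a → trans (+ᶠ-comm a (-ᶠ a)) (-ᶠ-inverseˡ a)
          ; ⁻¹-cong = cong (λ a → -ᶠ a) }
        ; comm = +ᶠ-comm }
      ; *-cong = cong₂ _*ᶠ_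
      ; *-assoc = *ᶠ-assoc
      ; *-identity = *ᶠ-identityˡ , λ a → trans (*ᶠ-comm a (fromℤ 1ℤ)) (*ᶠ-identityˡ a)
      ; distrib = distribˡ , λ a b c → trans (*ᶠ-comm (b +ᶠ c) a) (trans (distribˡ a b c) (cong₂ _+ᶠ_ (*ᶠ-comm a b) (*ᶠ-comm a c)))
      }
    ; *-comm = *ᶠ-comm
    }
    where
    ∀₁ = fromℤ-surjective
    ∀₂ : (P : 𝔽 p → 𝔽 p → Set) → (∀ i j → P (fromℤ i) (fromℤ j)) → ∀ a b → P a b
    ∀₂ P f = fromℤ-surjective (λ a → ∀ b → P a b) λ i → fromℤ-surjective (P (fromℤ i)) (f i)
    ∀₃ : (P : 𝔽 p → 𝔽 p → 𝔽 p → Set) → (∀ i j k → P (fromℤ i) (fromℤ j) (fromℤ k)) → ∀ a b c → P a b c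
    ∀₃ P f = fromℤ-surjective (λ a → ∀ b c → P a b c) λ i → ∀₂ (P (fromℤ i)) (f i)
    +ᶠ-comm : ∀ (a b : 𝔽 p) → a +ᶠ b ≡ b +ᶠ a
    +ᶠ-comm a b = cong fromℤ (ℤ.+-comm (toℤ a) (toℤ b))
    *ᶠ-comm : ∀ (a b : 𝔽 p) → a *ᶠ b ≡ b *ᶠ a
    *ᶠ-comm a b = cong fromℤ (ℤ.*-comm (toℤ a) (toℤ b))
    +ᶠ-assoc : ∀ (a b c : 𝔽 p) → a +ᶠ b +ᶠ c ≡ a +ᶠ (b +ᶠ c)
    +ᶠ-assoc = ∀₃ _ λ i j k → begin
      fromℤ i +ᶠ fromℤ j +ᶠ fromℤ k      ≡⟨ cong (_+ᶠ fromℤ k) (fromℤ-+ i j) ⟨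
      fromℤ (i + j) +ᶠ fromℤ k           ≡⟨ fromℤ-+ (i + j) k ⟨
      fromℤ (i + j + k)                  ≡⟨ cong fromℤ (ℤ.+-assoc i j k) ⟩
      fromℤ (i + (j + k))                ≡⟨ fromℤ-+ i (j + k) ⟩
      fromℤ i +ᶠ fromℤ (j + k)           ≡⟨ cong (fromℤ i +ᶠ_) (fromℤ-+ j k) ⟩
      fromℤ i +ᶠ (fromℤ j +ᶠ fromℤ k)    ∎
      where open ≡-Reasoning
    *ᶠ-assoc : ∀ (a b c : 𝔽 p) → a *ᶠ b *ᶠ c ≡ a *ᶠ (b *ᶠ c)
    *ᶠ-assoc = ∀₃ _ λ i j k → begin
      fromℤ i *ᶠ fromℤ j *ᶠ fromℤ k      ≡⟨ cong (_*ᶠ fromℤ k) (fromℤ-* i j) ⟨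
      fromℤ (i * j) *ᶠ fromℤ k           ≡⟨ fromℤ-* (i * j) k ⟨
      fromℤ (i * j * k)                  ≡⟨ cong fromℤ (ℤ.*-assoc i j k) ⟩
      fromℤ (i * (j * k))                ≡⟨ fromℤ-* i (j * k) ⟩
      fromℤ i *ᶠ fromℤ (j * k)           ≡⟨ cong (fromℤ i *ᶠ_) (fromℤ-* j k) ⟩
      fromℤ i *ᶠ (fromℤ j *ᶠ fromℤ k)    ∎
      where open ≡-Reasoning
    +ᶠ-identityˡ : ∀ (a : 𝔽 p) → fromℤ 0ℤ +ᶠ a ≡ a
    +ᶠ-identityˡ = ∀₁ _ λ i → trans (sym (fromℤ-+ 0ℤ i)) (cong fromℤ (ℤ.+-identityˡ i))
    *ᶠ-identityˡ : ∀ (a : 𝔽 p) → fromℤ 1ℤ *ᶠ a ≡ a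
    *ᶠ-identityˡ = ∀₁ _ λ i → trans (sym (fromℤ-* 1ℤ i)) (cong fromℤ (ℤ.*-identityˡ i))
    -ᶠ-inverseˡ : ∀ (a : 𝔽 p) → -ᶠ a +ᶠ a ≡ fromℤ 0ℤ
    -ᶠ-inverseˡ = ∀₁ _ λ i → trans (cong (_+ᶠ fromℤ i) (sym (fromℤ-neg i)))
      (trans (sym (fromℤ-+ (- i) i)) (cong fromℤ (ℤ.+-inverseˡ i)))
    distribˡ : ∀ (a b c : 𝔽 p) → a *ᶠ (b +ᶠ c) ≡ a *ᶠ b +ᶠ a *ᶠ c
    distribˡ = ∀₃ _ λ i j k → begin
      fromℤ i *ᶠ (fromℤ j +ᶠ fromℤ k)                 ≡⟨ cong (fromℤ i *ᶠ_) (fromℤ-+ j k) ⟨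
      fromℤ i *ᶠ fromℤ (j + k)                        ≡⟨ fromℤ-* i (j + k) ⟨
      fromℤ (i * (j + k))                             ≡⟨ cong fromℤ (ℤ.*-distribˡ-+ i j k) ⟩
      fromℤ (i * j + i * k)                           ≡⟨ fromℤ-+ (i * j) (i * k) ⟩
      fromℤ (i * j) +ᶠ fromℤ (i * k)                  ≡⟨ cong₂ _+ᶠ_ (fromℤ-* i j) (fromℤ-* i k) ⟩
      fromℤ i *ᶠ fromℤ j +ᶠ fromℤ i *ᶠ fromℤ k        ∎
      where open ≡-Reasoning

  module _ (prime : Prime p) where

    *ᶠ-inverse : ∀ (a : 𝔽 p) → a ≢ fromℤ 0ℤ → ∃ λ b → a *ᶠ b ≡ fromℤ 1ℤ
    *ᶠ-inverse a a≢0 with coprime-Bézout (prime⇒coprime prime {{ℕ.≢-nonZero n≢0}} (toℕ<n a))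
      where
      n≢0 : toℕ a ≢ 0
      n≢0 n≡0 = a≢0 (trans (sym (fromℤ-toℤ a)) (cong (fromℤ ∘ +_) n≡0))
    ... | Bézout.-+ x y 1+xp≡yn = fromℤ (+ y) , (begin
      a *ᶠ fromℤ (+ y)                  ≡⟨ cong (_*ᶠ fromℤ (+ y)) (fromℤ-toℤ a) ⟨
      fromℤ (toℤ a) *ᶠ fromℤ (+ y)      ≡⟨ fromℤ-* (toℤ a) (+ y) ⟨
      fromℤ (toℤ a * + y)               ≡⟨ fromℤ-cong (toℤ a * + y) 1ℤ (+ x) (begin
        toℤ a * + y                       ≡⟨ ℤ.*-comm (toℤ a) (+ y) ⟩
        + y * toℤ a                       ≡⟨ ℤ.pos-* y (toℕ a) ⟨
        + (y ℕ.* toℕ a)                   ≡⟨ cong +_ 1+xp≡yn ⟨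
        + (1 ℕ.+ x ℕ.* p)                 ≡⟨ cong (λ t → 1ℤ + t) (ℤ.pos-* x p) ⟩
        1ℤ + + x * + p                    ∎) ⟩
      fromℤ 1ℤ                          ∎)
      where open ≡-Reasoning
    -- With the 1 on this side of the Bézout identity, the representative `n` of `a` satisfies
    -- `y n ≡ -1` modulo `p`, so `-y` is the inverse.
    ... | Bézout.+- x y 1+yn≡xp = fromℤ (- (+ y)) , (begin
      a *ᶠ fromℤ (- (+ y))              ≡⟨ cong (_*ᶠ fromℤ (- (+ y))) (fromℤ-toℤ a) ⟨
      fromℤ (toℤ a) *ᶠ fromℤ (- (+ y))  ≡⟨ fromℤ-* (toℤ a) (- (+ y)) ⟨
      fromℤ (toℤ a * - (+ y))           ≡⟨ fromℤ-cong (toℤ a * - (+ y)) 1ℤ (- (+ x)) (begin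
        toℤ a * - (+ y)                   ≡⟨ eq (toℤ a) (+ y) ⟩
        1ℤ - (1ℤ + + y * toℤ a)           ≡⟨ cong (λ t → 1ℤ - t) (begin
          1ℤ + + y * toℤ a                  ≡⟨ cong (λ t → 1ℤ + t) (ℤ.pos-* y (toℕ a)) ⟨
          + (1 ℕ.+ y ℕ.* toℕ a)             ≡⟨ cong +_ 1+yn≡xp ⟩
          + (x ℕ.* p)                       ≡⟨ ℤ.pos-* x p ⟩
          + x * + p                         ∎) ⟩
        1ℤ - + x * + p                    ≡⟨ cong (λ t → 1ℤ + t) (ℤ.neg-distribˡ-* (+ x) (+ p)) ⟩
        1ℤ + - (+ x) * + p                ∎) ⟩
      fromℤ 1ℤ                          ∎)
      where
      open ≡-Reasoning
      eq : ∀ n y → n * - y ≡ 1ℤ - (1ℤ + y * n)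
      eq = solve-∀

    oddField : p ≥ 5 → OddField p
    oddField p≥5 = record
      { _+ᶠ_ = _+ᶠ_
      ; _*ᶠ_ = _*ᶠ_
      ; -ᶠ_ = λ a → -ᶠ a
      ; ι = fromℤ
      ; isCommutativeRing = isCommutativeRing
      ; ι-+ = fromℤ-+
      ; ι-* = fromℤ-*
      ; ι-neg = fromℤ-neg
      ; inverse = *ᶠ-inverse
      ; 2≢0 = 2≢0
      }
      where
      2≢0 : fromℤ (+ 2) ≢ fromℤ 0ℤ
      2≢0 eq with () ← trans (sym (fromℤ-small (ℕ.≤-trans (s≤s (s≤s (s≤s z≤n))) p≥5)))
                            (trans (cong toℕ eq) (fromℤ-small (ℕ.≤-trans (s≤s z≤n) p≥5)))

-- Sums over lists, and their reduction to sums over `Fin n`.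

private
  variable
    X Y : Set

total : (X → ℤ) → List X → ℤ
total f []       = 0ℤ
total f (x ∷ xs) = f x + total f xs

length-filter-total : {P : X → Set} (P? : U.Decidable P) → ∀ xs → + length (filter P? xs) ≡ total (λ x → 𝟙 (P? x)) xs
length-filter-total P? []       = refl
length-filter-total P? (x ∷ xs) with P? x
... | yes _ = cong (λ t → 1ℤ + t) (length-filter-total P? xs)
... | no _  = trans (length-filter-total P? xs) (sym (ℤ.+-identityˡ _))

total-filter : {P : X → Set} (P? : U.Decidable P) (f : X → ℤ) → ∀ xs →
  total f (filter P? xs) ≡ total (λ x → 𝟙 (P? x) * f x) xs
total-filter P? f []       = refl
total-filter P? f (x ∷ xs) with P? x
... | yes _ = cong₂ _+_ (sym (ℤ.*-identityˡ (f x))) (total-filter P? f xs)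
... | no _  = trans (total-filter P? f xs) (trans (sym (ℤ.+-identityˡ _)) (cong (_+ total (λ x → 𝟙 (P? x) * f x) xs) (sym (ℤ.*-zeroˡ (f x)))))

total-++ : ∀ (f : X → ℤ) xs ys → total f (xs ++ ys) ≡ total f xs + total f ys
total-++ f []       ys = sym (ℤ.+-identityˡ (total f ys))
total-++ f (x ∷ xs) ys = trans (cong (λ t → f x + t) (total-++ f xs ys)) (sym (ℤ.+-assoc (f x) (total f xs) (total f ys)))

total-map : ∀ (f : Y → ℤ) (g : X → Y) xs → total f (map g xs) ≡ total (f ∘ g) xs
total-map f g []       = refl
total-map f g (x ∷ xs) = cong (λ t → f (g x) + t) (total-map f g xs)

total-cartesianProduct : ∀ (f : X × Y → ℤ) xs ys →
  total f (cartesianProduct xs ys) ≡ total (λ x → total (λ y → f (x , y)) ys) xs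
total-cartesianProduct f []       ys = refl
total-cartesianProduct f (x ∷ xs) ys = trans
  (total-++ f (map (x ,_) ys) (cartesianProduct xs ys))
  (cong₂ _+_ (total-map f (x ,_) ys) (total-cartesianProduct f xs ys))

total-tabulate : ∀ {n} (f : X → ℤ) (g : Fin n → X) → total f (tabulate g) ≡ sum (f ∘ g)
total-tabulate {n = ℕ.zero}  f g = refl
total-tabulate {n = ℕ.suc n} f g = cong (λ t → f (g zero) + t) (total-tabulate f (g ∘ suc))

-- The entries of a list that differ from a given point.

module Moved {X : Set} (_≟_ : DecidableEquality X) where

  moved : X → List X → List X
  moved v = filter (λ w → ¬? (v ≟ w))

  -- Several flips may fix `v` and then all return `v`, so the list of flips need not be
  -- duplicate-free. The hypothesis confines repetitions to `v`, which the filter removes.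
  moved-unique : ∀ v {ws} → AllPairs (λ x y → x ≡ y → v ≡ x) ws → Unique (moved v ws)
  moved-unique v [] = []
  moved-unique v {w ∷ _} (p ∷ ps) with v ≟ w
  ... | yes _  = moved-unique v ps
  ... | no v≢w = All-filter⁺ (λ w → ¬? (v ≟ w)) (All.map (v≢w ∘_) p) ∷ moved-unique v ps

  length-moved-∷ : ∀ v w ws → length (moved v (w ∷ ws)) ≡ (if does (v ≟ w) then 0 else 1) ℕ.+ length (moved v ws)
  length-moved-∷ v w ws with v ≟ w
  ... | yes _ = refl
  ... | no _  = refl

  length-moved₃ : ∀ v w₁ w₂ w₃ → length (moved v (w₁ ∷ w₂ ∷ w₃ ∷ [])) ≡
    (if does (v ≟ w₁) then 0 else 1) ℕ.+ ((if does (v ≟ w₂) then 0 else 1) ℕ.+ ((if does (v ≟ w₃) then 0 else 1) ℕ.+ 0))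
  length-moved₃ v w₁ w₂ w₃ = trans (length-moved-∷ v w₁ _)
    (cong ((if does (v ≟ w₁) then 0 else 1) ℕ.+_) (trans (length-moved-∷ v w₂ _)
      (cong ((if does (v ≟ w₂) then 0 else 1) ℕ.+_) (length-moved-∷ v w₃ []))))

  -- If `k` of the three points equal `v`, then `3 - k` remain, while `weigh` is
  -- `k x + C(k,2) y + C(k,3) z`. The four hypotheses equate `g (3 - k)` with this value, and so
  -- determine `x`, `y` and `z` from `g`.
  moved-weigh : ∀ (g : ℕ → ℤ) {x y z} → g 3 ≡ 0ℤ → g 2 ≡ x → g 1 ≡ + 2 * x + y → g 0 ≡ + 3 * x + + 3 * y + z →
    ∀ v w₁ w₂ w₃ → g (length (moved v (w₁ ∷ w₂ ∷ w₃ ∷ []))) ≡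
      weigh x y z (𝟙 (v ≟ w₁)) (𝟙 (v ≟ w₂)) (𝟙 (v ≟ w₃))
  moved-weigh g {x} {y} {z} g₃ g₂ g₁ g₀ v w₁ w₂ w₃ =
    trans (cong g (length-moved₃ v w₁ w₂ w₃)) (go (does (v ≟ w₁)) (does (v ≟ w₂)) (does (v ≟ w₃)))
    where
    go : ∀ d₁ d₂ d₃ →
      g ((if d₁ then 0 else 1) ℕ.+ ((if d₂ then 0 else 1) ℕ.+ ((if d₃ then 0 else 1) ℕ.+ 0))) ≡
      weigh x y z (if d₁ then 1ℤ else 0ℤ) (if d₂ then 1ℤ else 0ℤ) (if d₃ then 1ℤ else 0ℤ)
    go false false false = trans g₃ (eq x y z)
      where
      eq : ∀ x y z → 0ℤ ≡ x * (0ℤ + 0ℤ + 0ℤ) + y * (0ℤ * 0ℤ + 0ℤ * 0ℤ + 0ℤ * 0ℤ) + z * (0ℤ * 0ℤ * 0ℤ)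
      eq = solve-∀
    go false false true  = trans g₂ (eq x y z)
      where
      eq : ∀ x y z → x ≡ x * (0ℤ + 0ℤ + 1ℤ) + y * (0ℤ * 0ℤ + 0ℤ * 1ℤ + 0ℤ * 1ℤ) + z * (0ℤ * 0ℤ * 1ℤ)
      eq = solve-∀
    go false true  false = trans g₂ (eq x y z)
      where
      eq : ∀ x y z → x ≡ x * (0ℤ + 1ℤ + 0ℤ) + y * (0ℤ * 1ℤ + 0ℤ * 0ℤ + 1ℤ * 0ℤ) + z * (0ℤ * 1ℤ * 0ℤ)
      eq = solve-∀
    go false true  true  = trans g₁ (eq x y z)
      where
      eq : ∀ x y z → + 2 * x + y ≡ x * (0ℤ + 1ℤ + 1ℤ) + y * (0ℤ * 1ℤ + 0ℤ * 1ℤ + 1ℤ * 1ℤ) + z * (0ℤ * 1ℤ * 1ℤ)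
      eq = solve-∀
    go true  false false = trans g₂ (eq x y z)
      where
      eq : ∀ x y z → x ≡ x * (1ℤ + 0ℤ + 0ℤ) + y * (1ℤ * 0ℤ + 1ℤ * 0ℤ + 0ℤ * 0ℤ) + z * (1ℤ * 0ℤ * 0ℤ)
      eq = solve-∀
    go true  false true  = trans g₁ (eq x y z)
      where
      eq : ∀ x y z → + 2 * x + y ≡ x * (1ℤ + 0ℤ + 1ℤ) + y * (1ℤ * 0ℤ + 1ℤ * 1ℤ + 0ℤ * 1ℤ) + z * (1ℤ * 0ℤ * 1ℤ)
      eq = solve-∀
    go true  true  false = trans g₁ (eq x y z)
      where
      eq : ∀ x y z → + 2 * x + y ≡ x * (1ℤ + 1ℤ + 0ℤ) + y * (1ℤ * 1ℤ + 1ℤ * 0ℤ + 1ℤ * 0ℤ) + z * (1ℤ * 1ℤ * 0ℤ)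
      eq = solve-∀
    go true  true  true  = trans g₀ (eq x y z)
      where
      eq : ∀ x y z → + 3 * x + + 3 * y + z ≡ x * (1ℤ + 1ℤ + 1ℤ) + y * (1ℤ * 1ℤ + 1ℤ * 1ℤ + 1ℤ * 1ℤ) + z * (1ℤ * 1ℤ * 1ℤ)
      eq = solve-∀

∈₃-elim : (P : X → Set) {a b c : X} → P a → P b → P c → ∀ {w} → w ∈ a ∷ b ∷ c ∷ [] → P w
∈₃-elim P Pa Pb Pc (here refl)                 = Pa
∈₃-elim P Pa Pb Pc (there (here refl))         = Pb
∈₃-elim P Pa Pb Pc (there (there (here refl))) = Pc

-- Degrees in the Vieta graph in terms of fixed flips.

module Degrees {p : ℕ} .{{_ : NonZero p}} (prime : Prime p) (p≥5 : p ≥ 5)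
  (K : 𝔽 p) (K≢2 : K ≢ fromℤ (+ 2)) (K≢-2 : K ≢ fromℤ (- (+ 2))) (C D : 𝔽 p)
  (C-def : C ≡ K *ᶠ K +ᶠ fromℤ (+ 2) *ᶠ K)
  (D-def : D ≡ -ᶠ (fromℤ (+ 2) *ᶠ (K *ᶠ K *ᶠ K) +ᶠ fromℤ (+ 3) *ᶠ (K *ᶠ K))) where

  open Residues
  field′ : OddField p
  field′ = oddField prime p≥5
  open QuadraticSums field′
  open ShiftedSurface field′ K K≢2 K≢-2
  open VietaEquation field′ K K≢2 K≢-2 C D C-def D-def
  open OddField field′ using (δ)
  open VietaGraph C D
  open Moved _≟ᴾ_

  -- The subtraction of the statement reduces an integer difference, whereas the ring solver knows
  -- only addition of a negative; this is where the flips pass from one to the other.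
  flip-≡ : ∀ x y z → y *ᶠ z -ᶠ C -ᶠ x ≡ flip x y z
  flip-≡ x y z = trans (-ᶠ≡+ᶠ-ᶠ (y *ᶠ z -ᶠ C) x) (cong (_+ᶠ -ᶠ x) (-ᶠ≡+ᶠ-ᶠ (y *ᶠ z) C))

  rhs-≡ : ∀ x y z → x *ᶠ y *ᶠ z -ᶠ C *ᶠ (x +ᶠ y +ᶠ z) +ᶠ D ≡ rhs x y z
  rhs-≡ x y z = cong (_+ᶠ D) (-ᶠ≡+ᶠ-ᶠ (x *ᶠ y *ᶠ z) (C *ᶠ (x +ᶠ y +ᶠ z)))

  solution⇒ : ∀ x y z → IsSolution (x , y , z) → defect x y z ≡ fromℤ 0ℤ
  solution⇒ x y z s = ≡⇒-‿≡0 (trans s (rhs-≡ x y z))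

  solution⇐ : ∀ x y z → defect x y z ≡ fromℤ 0ℤ → IsSolution (x , y , z)
  solution⇐ x y z e = trans (-‿≡0⇒≡ e) (sym (rhs-≡ x y z))

  flips-≡ : ∀ x y z → flips (x , y , z) ≡ (flip x y z , y , z) ∷ (x , flip y x z , z) ∷ (x , y , flip z x y) ∷ []
  flips-≡ x y z = cong₂ _∷_ (cong (_, y , z) (flip-≡ x y z)) (cong₂ _∷_
    (cong (λ t → x , t , z) (flip-≡ y x z))
    (cong (λ t → (x , y , t) ∷ []) (flip-≡ z x y)))

  ∈-flips : ∀ x y z {w} → w ∈ (flip x y z , y , z) ∷ (x , flip y x z , z) ∷ (x , y , flip z x y) ∷ [] → w ∈ flips (x , y , z)
  ∈-flips x y z {w} = subst (λ ws → w ∈ ws) (sym (flips-≡ x y z))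

  flips-elim : ∀ (P : Point → Set) x y z → P (flip x y z , y , z) → P (x , flip y x z , z) → P (x , y , flip z x y) →
    ∀ {w} → w ∈ flips (x , y , z) → P w
  flips-elim P x y z P₁ P₂ P₃ {w} w∈ = ∈₃-elim P P₁ P₂ P₃ (subst (λ ws → w ∈ ws) (flips-≡ x y z) w∈)

  flip-solution : ∀ x y z → IsSolution (x , y , z) → ∀ {w} → w ∈ flips (x , y , z) → IsSolution w
  flip-solution x y z s = flips-elim IsSolution x y z
    (solution⇐ (flip x y z) y z (trans (flip₁-equation x y z) (solution⇒ x y z s)))
    (solution⇐ x (flip y x z) z (trans (flip₂-equation x y z) (solution⇒ x y z s)))
    (solution⇐ x y (flip z x y) (trans (flip₃-equation x y z) (solution⇒ x y z s)))

  flips-symmetric : ∀ x y z {v} → v ∈ flips (x , y , z) → (x , y , z) ∈ flips v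
  flips-symmetric x y z = flips-elim (λ u → (x , y , z) ∈ flips u) x y z
    (∈-flips (flip x y z) y z (here (cong (_, y , z) (sym (flip-involutive x y z)))))
    (∈-flips x (flip y x z) z (there (here (cong (λ t → x , t , z) (sym (flip-involutive y x z))))))
    (∈-flips x y (flip z x y) (there (there (here (cong (λ t → x , y , t) (sym (flip-involutive z x y)))))))

  ∈-vertices : ∀ {v} → IsSolution v → v ∈ vertices
  ∈-vertices {x , y , z} s = ∈-filter⁺ isSolution?
    (∈-cartesianProduct⁺ (∈-allFin x) (∈-cartesianProduct⁺ (∈-allFin y) (∈-allFin z))) s

  vertices-unique : Unique vertices
  vertices-unique = filter⁺ isSolution? (cartesianProduct⁺ (allFin⁺ p) (cartesianProduct⁺ (allFin⁺ p) (allFin⁺ p)))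

  -- Distinct flips change distinct coordinates, so two of them agree only if both are trivial.
  flips-moved-unique : ∀ v → Unique (moved v (flips v))
  flips-moved-unique v@(x , y , z) = moved-unique v
    (((λ e → cong (_, y , z) (sym (cong proj₁ e))) ∷ (λ e → cong (_, y , z) (sym (cong proj₁ e))) ∷ []) ∷
     ((λ e → cong (λ t → x , t , z) (sym (cong (proj₁ ∘ proj₂) e))) ∷ []) ∷
     [] ∷ [])

  -- Flips are involutions, so the two alternatives in `Adjacent` amount to the same, and they
  -- preserve solutions, so every flip of `v` is a vertex. Two duplicate-free lists with the same
  -- members are permutations of each other and have equal length.
  degree-moved : ∀ x y z → IsSolution (x , y , z) →
    degree (x , y , z) ≡ length (moved (x , y , z) (flips (x , y , z)))
  degree-moved x y z s = ↭-length (∼bag⇒↭ (unique∧set⇒bag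
    (filter⁺ (adjacent? v) vertices-unique) (flips-moved-unique v) (mk⇔ to from)))
    where
    v = x , y , z
    to : ∀ {w} → w ∈ filter (adjacent? v) vertices → w ∈ moved v (flips v)
    to w∈ with ∈-filter⁻ (adjacent? v) {xs = vertices} w∈
    ... | _ , v≢w , inj₁ w∈flips = ∈-filter⁺ (λ w → ¬? (v ≟ᴾ w)) w∈flips v≢w
    ... | _ , v≢w , inj₂ v∈flips = ∈-filter⁺ (λ w → ¬? (v ≟ᴾ w)) (flips-symmetric _ _ _ v∈flips) v≢w
    from : ∀ {w} → w ∈ moved v (flips v) → w ∈ filter (adjacent? v) vertices
    from w∈ with ∈-filter⁻ (λ w → ¬? (v ≟ᴾ w)) {xs = flips v} w∈
    ... | w∈flips , v≢w = ∈-filter⁺ (adjacent? v) (∈-vertices (flip-solution x y z s w∈flips)) (v≢w , inj₁ w∈flips)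

  pt : 𝔽 p → 𝔽 p → 𝔽 p → Point
  pt a b c = shift a , shift b , shift c

  solution-δ : ∀ a b c → 𝟙 (isSolution? (pt a b c)) ≡ δ (q a b c)
  solution-δ a b c = 𝟙-cong (isSolution? (pt a b c)) (q a b c ≟ᶠ fromℤ 0ℤ)
    (λ s → trans (sym (equation-shift a b c)) (solution⇒ (shift a) (shift b) (shift c) s))
    (λ e → solution⇐ (shift a) (shift b) (shift c) (trans (equation-shift a b c) e))

  -- A point and its flip differ in at most one coordinate. Taking the two implications as arguments
  -- lets one lemma serve whichever coordinate that is.
  fixed-δ : ∀ x y z {v w : Point} → (v ≡ w → x ≡ y *ᶠ z -ᶠ C -ᶠ x) →
    (x ≡ y *ᶠ z -ᶠ C -ᶠ x → v ≡ w) → 𝟙 (v ≟ᴾ w) ≡ δ (displacement x y z)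
  fixed-δ x y z {v} {w} to from = 𝟙-cong (v ≟ᴾ w) (displacement x y z ≟ᶠ fromℤ 0ℤ)
    (λ e → ≡⇒-‿≡0 (trans (to e) (flip-≡ x y z)))
    (λ e → from (trans (-‿≡0⇒≡ e) (sym (flip-≡ x y z))))

  degree-δ : ∀ {Q : ℕ → Set} (Q? : U.Decidable Q) {i j k} →
    𝟙 (Q? 3) ≡ 0ℤ → 𝟙 (Q? 2) ≡ i → 𝟙 (Q? 1) ≡ + 2 * i + j → 𝟙 (Q? 0) ≡ + 3 * i + + 3 * j + k →
    ∀ x y z → IsSolution (x , y , z) → 𝟙 (Q? (degree (x , y , z))) ≡
      weigh i j k (δ (displacement x y z)) (δ (displacement y x z)) (δ (displacement z x y))
  degree-δ Q? {i} {j} {k} Q₃ Q₂ Q₁ Q₀ x y z s = begin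
    𝟙 (Q? (degree v))                                         ≡⟨ cong (λ n → 𝟙 (Q? n)) (degree-moved x y z s) ⟩
    𝟙 (Q? (length (moved v (w₁ ∷ w₂ ∷ w₃ ∷ []))))             ≡⟨ moved-weigh (λ n → 𝟙 (Q? n)) Q₃ Q₂ Q₁ Q₀ v w₁ w₂ w₃ ⟩
    weigh i j k (𝟙 (v ≟ᴾ w₁)) (𝟙 (v ≟ᴾ w₂)) (𝟙 (v ≟ᴾ w₃))     ≡⟨ weigh-cong i j k {𝟙 (v ≟ᴾ w₁)} {𝟙 (v ≟ᴾ w₂)} {𝟙 (v ≟ᴾ w₃)} {δ (displacement x y z)} {δ (displacement y x z)} {δ (displacement z x y)}
      (fixed-δ x y z (cong proj₁) (cong (_, y , z)))
      (fixed-δ y x z (cong (proj₁ ∘ proj₂)) (cong (λ t → x , t , z)))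
      (fixed-δ z x y (cong (proj₂ ∘ proj₂)) (cong (λ t → x , y , t))) ⟩
    weigh i j k (δ (displacement x y z)) (δ (displacement y x z)) (δ (displacement z x y)) ∎
    where
    open ≡-Reasoning
    v w₁ w₂ w₃ : Point
    v  = x , y , z
    w₁ = y *ᶠ z -ᶠ C -ᶠ x , y , z
    w₂ = x , x *ᶠ z -ᶠ C -ᶠ y , z
    w₃ = x , y , x *ᶠ y -ᶠ C -ᶠ z

  -- Counts over the vertex list and the final formulas.

  sum-vertices : ∀ f → total f vertices ≡ sum₃ (λ a b c → 𝟙 (isSolution? (pt a b c)) * f (pt a b c))
  sum-vertices f = begin
    total f vertices
      ≡⟨ total-filter isSolution? f (cartesianProduct (allFin p) (cartesianProduct (allFin p) (allFin p))) ⟩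
    total g (cartesianProduct (allFin p) (cartesianProduct (allFin p) (allFin p)))
      ≡⟨ trans (total-cartesianProduct g (allFin p) (cartesianProduct (allFin p) (allFin p))) (total-tabulate (λ x → total (λ yz → g (x , yz)) (cartesianProduct (allFin p) (allFin p))) id) ⟩
    sum (λ x → total (λ yz → g (x , yz)) (cartesianProduct (allFin p) (allFin p)))
      ≡⟨ sum-cong-≗ (λ x → trans (total-cartesianProduct (λ yz → g (x , yz)) (allFin p) (allFin p)) (total-tabulate (λ y → total (λ z → g (x , y , z)) (allFin p)) id)) ⟩
    sum (λ x → sum (λ y → total (λ z → g (x , y , z)) (allFin p)))
      ≡⟨ sum-cong-≗ (λ x → sum-cong-≗ λ y → total-tabulate (λ z → g (x , y , z)) id) ⟩
    sum₃ (λ x y z → g (x , y , z))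
      ≡⟨ sum₃-shift (λ x y z → g (x , y , z)) ⟨
    sum₃ (λ a b c → g (pt a b c)) ∎
    where
    open ≡-Reasoning
    g : Point → ℤ
    g v = 𝟙 (isSolution? v) * f v

  count-vertices : + #vertices ≡ + p * + p + 1ℤ + + p * s₊ * n₀
  count-vertices = begin
    + length vertices                                       ≡⟨ total-one vertices ⟩
    total (λ _ → 1ℤ) vertices                               ≡⟨ sum-vertices (λ _ → 1ℤ) ⟩
    sum₃ (λ a b c → 𝟙 (isSolution? (pt a b c)) * 1ℤ)        ≡⟨ sum₃-cong (λ a b c → trans (ℤ.*-identityʳ _) (solution-δ a b c)) ⟩
    sum₃ (λ a b c → δ (q a b c))                            ≡⟨ points-total ⟩
    + p * + p + 1ℤ + + p * s₊ * n₀ ∎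
    where
    open ≡-Reasoning
    total-one : ∀ (xs : List Point) → + length xs ≡ total (λ _ → 1ℤ) xs
    total-one []       = refl
    total-one (x ∷ xs) = cong (λ t → 1ℤ + t) (total-one xs)

  count-degrees : {Q : ℕ → Set} (Q? : U.Decidable Q) {x y z : ℤ} →
    𝟙 (Q? 3) ≡ 0ℤ → 𝟙 (Q? 2) ≡ x → 𝟙 (Q? 1) ≡ + 2 * x + y → 𝟙 (Q? 0) ≡ + 3 * x + + 3 * y + z →
    + length (filter (λ v → Q? (degree v)) vertices) ≡
    + 3 * x * (+ p - + 3 - s₋) + + 3 * y * (1ℤ + n₁) + z
  count-degrees Q? {x} {y} {z} Q₃ Q₂ Q₁ Q₀ = begin
    + length (filter (λ v → Q? (degree v)) vertices)
      ≡⟨ length-filter-total (λ v → Q? (degree v)) vertices ⟩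
    total (λ v → 𝟙 (Q? (degree v))) vertices
      ≡⟨ sum-vertices (λ v → 𝟙 (Q? (degree v))) ⟩
    sum₃ (λ a b c → 𝟙 (isSolution? (pt a b c)) * 𝟙 (Q? (degree (pt a b c))))
      ≡⟨ sum₃-cong term ⟩
    sum₃ (λ a b c → δ (q a b c) * weigh x y z (δ (ℓ a b c)) (δ (ℓ b a c)) (δ (ℓ c a b)))
      ≡⟨ sum₃-weigh x y z ⟩
    + 3 * x * (+ p - + 3 - s₋) + + 3 * y * (1ℤ + n₁) + z ∎
    where
    open ≡-Reasoning
    profile : ∀ a b c → IsSolution (pt a b c) →
      𝟙 (Q? (degree (pt a b c))) ≡ weigh x y z (δ (ℓ a b c)) (δ (ℓ b a c)) (δ (ℓ c a b))
    profile a b c s = trans (degree-δ Q? Q₃ Q₂ Q₁ Q₀ (shift a) (shift b) (shift c) s)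
      (weigh-cong x y z (cong δ (flip-shift a b c)) (cong δ (flip-shift b a c)) (cong δ (flip-shift c a b)))
    term : ∀ a b c → 𝟙 (isSolution? (pt a b c)) * 𝟙 (Q? (degree (pt a b c))) ≡
      δ (q a b c) * weigh x y z (δ (ℓ a b c)) (δ (ℓ b a c)) (δ (ℓ c a b))
    term a b c = trans (go (isSolution? (pt a b c)))
      (cong (_* weigh x y z (δ (ℓ a b c)) (δ (ℓ b a c)) (δ (ℓ c a b))) (solution-δ a b c))
      where
      -- The degree is known only at solutions; elsewhere both products are 0.
      go : (s? : Dec (IsSolution (pt a b c))) → 𝟙 s? * 𝟙 (Q? (degree (pt a b c))) ≡
        𝟙 s? * weigh x y z (δ (ℓ a b c)) (δ (ℓ b a c)) (δ (ℓ c a b))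
      go (yes s) = cong (1ℤ *_) (profile a b c s)
      go (no _)  = trans (ℤ.*-zeroˡ (𝟙 (Q? (degree (pt a b c))))) (sym (ℤ.*-zeroˡ (weigh x y z (δ (ℓ a b c)) (δ (ℓ b a c)) (δ (ℓ c a b)))))

  σ-≡ : ∀ a → OddField.σ field′ a ≡ σ a
  σ-≡ a = refl

  vertices-formula : ∀ s n → s₊ ≡ s → n₀ ≡ n → + #vertices ≡ + p * + p + + 1 + n * s * + p
  vertices-formula s n s₊≡ n₀≡ = trans count-vertices
    (trans (eq (+ p) s₊ n₀) (cong₂ (λ s n → + p * + p + + 1 + n * s * + p) s₊≡ n₀≡))
    where
    eq : ∀ p s n → p * p + 1ℤ + p * s * n ≡ p * p + + 1 + n * s * p
    eq = solve-∀

  degree-formulas :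
      + #deficient ≡ + 3 * + p - + 11 - + 3 * s₋ - + 3 * n₁
    × + #ofDegree 2 ≡ + 3 * (+ p - + 4 - s₋ - + 2 * n₁)
    × + #ofDegree 1 ≡ + 3 * n₁
    × + #ofDegree 0 ≡ 1ℤ
  degree-formulas =
    -- The triples solve the equations of `moved-weigh`: `(1, -1, 1)` is inclusion and exclusion for
    -- "at least one flip fixes the point", and `(1, -2, 3)`, `(0, 1, -3)`, `(0, 0, 1)` single out
    -- exactly one, two and three such flips.
    trans (count-degrees (_<? 3) {1ℤ} { -1ℤ} {1ℤ} refl refl refl refl) (eq-deficient (+ p) s₋ n₁) ,
    trans (count-degrees (_≟ 2) {1ℤ} { - (+ 2)} {+ 3} refl refl refl refl) (eq₂ (+ p) s₋ n₁) ,
    trans (count-degrees (_≟ 1) {0ℤ} {1ℤ} { - (+ 3)} refl refl refl refl) (eq₁ (+ p) s₋ n₁) ,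
    trans (count-degrees (_≟ 0) {0ℤ} {0ℤ} {1ℤ} refl refl refl refl) (eq₀ (+ p) s₋ n₁)
    where
    eq-deficient : ∀ n s t → + 3 * 1ℤ * (n - + 3 - s) + + 3 * -1ℤ * (1ℤ + t) + 1ℤ ≡ + 3 * n - + 11 - + 3 * s - + 3 * t
    eq-deficient = solve-∀
    eq₂ : ∀ n s t → + 3 * 1ℤ * (n - + 3 - s) + + 3 * - (+ 2) * (1ℤ + t) + + 3 ≡ + 3 * (n - + 4 - s - + 2 * t)
    eq₂ = solve-∀
    eq₁ : ∀ n s t → + 3 * 0ℤ * (n - + 3 - s) + + 3 * 1ℤ * (1ℤ + t) + - (+ 3) ≡ + 3 * t
    eq₁ = solve-∀
    eq₀ : ∀ n s t → + 3 * 0ℤ * (n - + 3 - s) + + 3 * 0ℤ * (1ℤ + t) + 1ℤ ≡ 1ℤ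
    eq₀ = solve-∀

  -- Serves both `K = 0`, with `s = σ (-1)`, and `K = -1`, with `s = 0`.
  n₁≡0-degrees : ∀ s → s₋ ≡ s → n₁ ≡ 0ℤ →
      + #deficient ≡ + 3 * + p - + 11 - + 3 * s
    × + #ofDegree 2 ≡ + 3 * (+ p - + 4 - s)
    × #ofDegree 1 ≡ 0
    × #ofDegree 0 ≡ 1
  n₁≡0-degrees s s₋≡ n₁≡ =
    trans (proj₁ degree-formulas)
      (trans (cong₂ (λ s t → + 3 * + p - + 11 - + 3 * s - + 3 * t) s₋≡ n₁≡) (eq (+ p) s)) ,
    trans (proj₁ (proj₂ degree-formulas))
      (trans (cong₂ (λ s t → + 3 * (+ p - + 4 - s - + 2 * t)) s₋≡ n₁≡) (eq₂ (+ p) s)) ,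
    ℤ.+-injective (trans (proj₁ (proj₂ (proj₂ degree-formulas))) (cong (λ t → + 3 * t) n₁≡)) ,
    ℤ.+-injective (proj₂ (proj₂ (proj₂ degree-formulas)))
    where
    eq : ∀ n s → + 3 * n - + 11 - + 3 * s - + 3 * 0ℤ ≡ + 3 * n - + 11 - + 3 * s
    eq = solve-∀
    eq₂ : ∀ n s → + 3 * (n - + 4 - s - + 2 * 0ℤ) ≡ + 3 * (n - + 4 - s)
    eq₂ = solve-∀

  n₁≡1-degrees : ∀ s → s₋ ≡ s → n₁ ≡ 1ℤ →
      + #deficient ≡ + 3 * + p - + 14 - + 3 * s
    × + #ofDegree 2 ≡ + 3 * (+ p - + 6 - s)
    × #ofDegree 1 ≡ 3
    × #ofDegree 0 ≡ 1
  n₁≡1-degrees s s₋≡ n₁≡ =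
    trans (proj₁ degree-formulas)
      (trans (cong₂ (λ s t → + 3 * + p - + 11 - + 3 * s - + 3 * t) s₋≡ n₁≡) (eq (+ p) s)) ,
    trans (proj₁ (proj₂ degree-formulas))
      (trans (cong₂ (λ s t → + 3 * (+ p - + 4 - s - + 2 * t)) s₋≡ n₁≡) (eq₂ (+ p) s)) ,
    ℤ.+-injective (trans (proj₁ (proj₂ (proj₂ degree-formulas))) (cong (λ t → + 3 * t) n₁≡)) ,
    ℤ.+-injective (proj₂ (proj₂ (proj₂ degree-formulas)))
    where
    eq : ∀ n s → + 3 * n - + 11 - + 3 * s - + 3 * 1ℤ ≡ + 3 * n - + 14 - + 3 * s
    eq = solve-∀
    eq₂ : ∀ n s → + 3 * (n - + 4 - s - + 2 * 1ℤ) ≡ + 3 * (n - + 6 - s)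
    eq₂ = solve-∀

  K≡0-case : K ≡ fromℤ (+ 0) →
    let s = σ {p} (fromℤ (- (+ 1))) in
      + #vertices ≡ + p * + p + + 1 + + 3 * s * + p
    × + #deficient ≡ + 3 * + p - + 11 - + 3 * s
    × + #ofDegree 2 ≡ + 3 * (+ p - + 4 - s)
    × #ofDegree 1 ≡ 0
    × #ofDegree 0 ≡ 1
  K≡0-case K≡0 =
    vertices-formula (σ {p} (fromℤ (- (+ 1)))) (+ 3)
      (trans (proj₁ (K≡0-values K≡0)) (σ-≡ (fromℤ (- (+ 1))))) (proj₁ (proj₂ (proj₂ (K≡0-values K≡0)))) ,
    n₁≡0-degrees (σ {p} (fromℤ (- (+ 1))))
      (trans (proj₁ (proj₂ (K≡0-values K≡0))) (σ-≡ (fromℤ (- (+ 1))))) (proj₂ (proj₂ (proj₂ (K≡0-values K≡0))))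

  K≡-1-case : K ≡ fromℤ (- (+ 1)) →
      + #vertices ≡ + p * + p + + 1 + + 2 * σ {p} (fromℤ (- (+ 3))) * + p
    × + #deficient ≡ + 3 * + p - + 11
    × + #ofDegree 2 ≡ + 3 * (+ p - + 4)
    × #ofDegree 1 ≡ 0
    × #ofDegree 0 ≡ 1
  K≡-1-case K≡-1 =
    vertices-formula (σ {p} (fromℤ (- (+ 3)))) (+ 2)
      (trans (proj₁ (K≡-1-values K≡-1)) (σ-≡ (fromℤ (- (+ 3))))) (proj₁ (proj₂ (proj₂ (K≡-1-values K≡-1)))) ,
    trans (proj₁ degrees) (eq (+ p)) , trans (proj₁ (proj₂ degrees)) (eq₂ (+ p)) , proj₂ (proj₂ degrees)
    where
    degrees = n₁≡0-degrees 0ℤ (proj₁ (proj₂ (K≡-1-values K≡-1))) (proj₂ (proj₂ (proj₂ (K≡-1-values K≡-1))))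
    eq : ∀ n → + 3 * n - + 11 - + 3 * 0ℤ ≡ + 3 * n - + 11
    eq = solve-∀
    eq₂ : ∀ n → + 3 * (n - + 4 - 0ℤ) ≡ + 3 * (n - + 4)
    eq₂ = solve-∀

  generic-case : K ≢ fromℤ (+ 0) → K ≢ fromℤ (- (+ 1)) →
    let s = σ (-ᶠ K -ᶠ fromℤ (+ 1)) in
      + #vertices ≡ + p * + p + + 1 + + 3 * σ (K *ᶠ K -ᶠ fromℤ (+ 4)) * + p
    × + #deficient ≡ + 3 * + p - + 14 - + 3 * s
    × + #ofDegree 2 ≡ + 3 * (+ p - + 6 - s)
    × #ofDegree 1 ≡ 3
    × #ofDegree 0 ≡ 1
  generic-case K≢0 K≢-1 =
    vertices-formula (σ (K *ᶠ K -ᶠ fromℤ (+ 4))) (+ 3)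
      (trans (proj₁ (generic-values K≢0 K≢-1)) (trans (σ-≡ (K *ᶠ K +ᶠ -ᶠ fromℤ (+ 4))) (cong σ (sym (-ᶠ≡+ᶠ-ᶠ (K *ᶠ K) (fromℤ (+ 4)))))))
      (proj₁ (proj₂ (generic-values K≢0 K≢-1))) ,
    n₁≡1-degrees (σ (-ᶠ K -ᶠ fromℤ (+ 1)))
      (trans (σ-≡ (-ᶠ K +ᶠ -ᶠ fromℤ (+ 1))) (cong σ (sym (-ᶠ≡+ᶠ-ᶠ (-ᶠ K) (fromℤ (+ 1))))))
      (proj₂ (proj₂ (generic-values K≢0 K≢-1)))

theorem11p4 :
    (p : ℕ) .{{_ : NonZero p}} → Prime p → p ≥ 5 →
    (K : 𝔽 p) → K ≢ fromℤ (+ 2) → K ≢ fromℤ (- (+ 2)) →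
    let C = K *ᶠ K +ᶠ fromℤ (+ 2) *ᶠ K
        D = -ᶠ (fromℤ (+ 2) *ᶠ (K *ᶠ K *ᶠ K) +ᶠ fromℤ (+ 3) *ᶠ (K *ᶠ K))
        open VietaGraph C D
    in
      (K ≡ fromℤ (+ 0) →
        let s = σ {p} (fromℤ (- (+ 1))) in
          + #vertices ≡ + p * + p + + 1 + + 3 * s * + p
        × + #deficient ≡ + 3 * + p - + 11 - + 3 * s
        × + #ofDegree 2 ≡ + 3 * (+ p - + 4 - s)
        × #ofDegree 1 ≡ 0
        × #ofDegree 0 ≡ 1)
    × (K ≡ fromℤ (- (+ 1)) →
          + #vertices ≡ + p * + p + + 1 + + 2 * σ {p} (fromℤ (- (+ 3))) * + p
        × + #deficient ≡ + 3 * + p - + 11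
        × + #ofDegree 2 ≡ + 3 * (+ p - + 4)
        × #ofDegree 1 ≡ 0
        × #ofDegree 0 ≡ 1)
    × (K ≢ fromℤ (+ 0) → K ≢ fromℤ (- (+ 1)) →
        let s = σ (-ᶠ K -ᶠ fromℤ (+ 1)) in
          + #vertices ≡ + p * + p + + 1 + + 3 * σ (K *ᶠ K -ᶠ fromℤ (+ 4)) * + p
        × + #deficient ≡ + 3 * + p - + 14 - + 3 * s
        × + #ofDegree 2 ≡ + 3 * (+ p - + 6 - s)
        × #ofDegree 1 ≡ 3
        × #ofDegree 0 ≡ 1)
theorem11p4 p p-prime p≥5 K K≢2 K≢-2 = K≡0-case , K≡-1-case , generic-case
  -- Until here `C` and `D` are variables, hence atoms for the ring solver except where `C-def` and
  -- `D-def` rewrite them; with the actual values both equations hold by `refl`.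
  where open Degrees p-prime p≥5 K K≢2 K≢-2 _ _ refl refl
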